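{- Let $X$ be an unweighted bipartite graph on $n$ vertices admitting local $\epsilon$-uniform mixing at a vertex $u$ relative to the adjacency matrix $A(X)$. Then $n$ or $\deg u$ is even. Moreover, the number of vertices of $X$ whose degree $d$ satisfies $d\equiv 2$ or $3 \pmod 4$ is even if and only if $|E(X)|$ and $\frac12 n\deg u$ have the same parity.
   Context: Graphs are finite, simple, undirected and connected; unweighted means all edges have weight $1$. Put $U(t)=e^{\mathrm{i}tA(X)}$. $\mathbf{e}_u$ is the characteristic vector of $u$, $\mathbf{1}$ the all-ones vector, $\circ$ the entrywise product. Local $\epsilon$-uniform mixing occurs at $u$ relative to $A(X)$ if for each $\epsilon>0$ there is a time $\tau\in\mathbb{R}$ such that $\big\|(U(\tau)\mathbf{e}_u)\circ(\overline{U(\tau)}\mathbf{e}_u)-\tfrac1n\mathbf{1}\big\|<\epsilon$. -}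

module Defs where

open import Data.Bool.Base using (Bool; if_then_else_)
open import Data.Fin.Base using (Fin; zero; suc)
import Data.Fin.Properties as Fin
open import Data.Integer.Base as ℤ using (+_; -[1+_])
import Data.Integer.Properties as ℤ
open import Data.Integer.Tactic.RingSolver as ℤSolver using ()
open import Data.List.Base using (List; length; filter; allFin; cartesianProduct)
open import Data.Nat.Base as ℕ using (ℕ; zero; suc; _!; z≤n; s≤s)
open import Data.Nat.Coprimality as Coprime using (1-coprimeTo)
import Data.Nat.Properties as ℕ
open import Data.Nat.Tactic.RingSolver as ℕSolver using ()
open import Data.Product using (_×_; _,_; proj₁; proj₂; ∃-syntax; Σ-syntax)
open import Data.Rational
open import Data.Rational.Properties
open import Data.Rational.Solver using (module +-*-Solver)
open import Data.Rational.Unnormalised.Base as ℚᵘ using (mkℚᵘ; *≡*)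
import Data.Rational.Unnormalised.Properties as ℚᵘ
open import Data.Sum.Base using (_⊎_; inj₁; inj₂)
open import Data.Vec.Functional using (foldr)
open import Level using (0ℓ)
open import Relation.Binary.Construct.Closure.ReflexiveTransitive using (Star)
open import Relation.Binary.Core using (Rel)
open import Relation.Binary.Definitions using (Decidable; Irreflexive; Symmetric)
open import Relation.Binary.PropositionalEquality
open import Relation.Nullary using (¬_; Dec; yes; no; does)
open import Relation.Nullary.Decidable using (_×-dec_; _⊎-dec_)

-- Opaque only to keep the type checker from unfolding rational arithmetic.
opaque
  ι : ℕ → ℚ
  ι n = mkℚ (+ n) 0 (Coprime.sym (1-coprimeTo n))

  -- δ n = 1/(n+1)
  δ : ℕ → ℚ
  δ n = mkℚ (+ 1) n (1-coprimeTo (suc n))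

  ι-+ : ∀ m n → ι (m ℕ.+ n) ≡ ι m + ι n
  ι-+ m n = toℚᵘ-injective (ℚᵘ.≃-trans (*≡* (lemma (+ m) (+ n))) (ℚᵘ.≃-sym (toℚᵘ-homo-+ (ι m) (ι n))))
    where
    lemma : ∀ a b → (a ℤ.+ b) ℤ.* (+ 1) ≡ (a ℤ.* + 1 ℤ.+ b ℤ.* + 1) ℤ.* (+ 1)
    lemma = ℤSolver.solve-∀

  ι-* : ∀ m n → ι (m ℕ.* n) ≡ ι m * ι n
  ι-* m n = toℚᵘ-injective (ℚᵘ.≃-trans (*≡* (cong (ℤ._* + 1) (ℤ.pos-* m n))) (ℚᵘ.≃-sym (toℚᵘ-homo-* (ι m) (ι n))))

  ι-mono : ∀ {m n} → m ℕ.≤ n → ι m ≤ ι n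
  ι-mono m≤n = *≤* (ℤ.*-monoʳ-≤-nonNeg (+ 1) (ℤ.+≤+ m≤n))

  0≤ι : ∀ n → 0ℚ ≤ ι n
  0≤ι n = ι-mono z≤n

  ι-0 : ι 0 ≡ 0ℚ
  ι-0 = refl

  ι-1 : ι 1 ≡ 1ℚ
  ι-1 = refl

  ι-2 : ι 2 ≡ 1ℚ + 1ℚ
  ι-2 = refl

  1≤ι : ∀ n → 1ℚ ≤ ι (suc n)
  1≤ι n = ι-mono (s≤s z≤n)

  ι-mono-< : ∀ {m n} → m ℕ.< n → ι m < ι n
  ι-mono-< m<n = *<* (ℤ.*-monoʳ-<-pos (+ 1) (ℤ.+<+ m<n))

  0<δ : ∀ n → 0ℚ < δ n
  0<δ n = positive⁻¹ (δ n)

  0≤δ : ∀ n → 0ℚ ≤ δ n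
  0≤δ n = <⇒≤ (0<δ n)

  δ-inv : ∀ n → δ n * ι (suc n) ≡ 1ℚ
  δ-inv n = *-inverseˡ (ι (suc n))

  ∣-∣≤ι : ∀ p → ∣ p ∣ ≤ ι ℤ.∣ ↥ p ∣
  ∣-∣≤ι (mkℚ n d _) = *≤* (ℤ.*-monoˡ-≤-nonNeg (+ ℤ.∣ n ∣) (ℤ.+≤+ (s≤s z≤n)))

  δ-anti : ∀ {m n} → m ℕ.≤ n → δ n ≤ δ m
  δ-anti m≤n = *≤* (ℤ.*-monoˡ-≤-nonNeg (+ 1) (ℤ.+≤+ (s≤s m≤n)))

  δ≤ι : ∀ n → δ n ≤ ι 1
  δ≤ι n = δ-anti (z≤n {n})

  +1/ : ∀ n → + 1 / suc n ≡ δ n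
  +1/ n = normalize-coprime (1-coprimeTo (suc n))

  archimedean : ∀ ε → 0ℚ < ε → ∃[ N ] (∀ n → N ℕ.≤ n → δ n ≤ ε)
  archimedean (mkℚ (+ 0) d c) 0<ε with *<* (ℤ.+<+ ()) ← 0<ε
  archimedean (mkℚ (-[1+ a ]) d c) 0<ε with *<* () ← 0<ε
  archimedean (mkℚ (+ suc a) d c) _ = d , λ n d≤n → ≤-trans (δ-anti d≤n)
    (*≤* (ℤ.*-monoʳ-≤-nonNeg (+ suc d) (ℤ.+≤+ (s≤s (z≤n {a})))))

0<1 : 0ℚ < 1ℚ
0<1 = positive⁻¹ 1ℚ

0≤1 : 0ℚ ≤ 1ℚ
0≤1 = <⇒≤ 0<1

0<½ : 0ℚ < ½
0<½ = positive⁻¹ ½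

+-pos : ∀ {p q} → 0ℚ < p → 0ℚ < q → 0ℚ < p + q
+-pos 0<p 0<q = +-mono-< 0<p 0<q

*-pos : ∀ {p q} → 0ℚ < p → 0ℚ < q → 0ℚ < p * q
*-pos {p} {q} 0<p 0<q = positive⁻¹ (p * q) {{pos*pos⇒pos p {{positive 0<p}} q {{positive 0<q}}}}

*-nonneg : ∀ {p q} → 0ℚ ≤ p → 0ℚ ≤ q → 0ℚ ≤ p * q
*-nonneg {p} {q} 0≤p 0≤q = nonNegative⁻¹ (p * q) {{nonNeg*nonNeg⇒nonNeg p {{nonNegative 0≤p}} q {{nonNegative 0≤q}}}}

*-mono : ∀ {p q r s} → 0ℚ ≤ p → p ≤ q → 0ℚ ≤ r → r ≤ s → p * r ≤ q * s
*-mono {p} {q} {r} {s} 0≤p p≤q 0≤r r≤s = ≤-trans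
  (*-monoʳ-≤-nonNeg r {{nonNegative 0≤r}} p≤q)
  (*-monoˡ-≤-nonNeg q {{nonNegative (≤-trans 0≤p p≤q)}} r≤s)

½+½ : ∀ p → ½ * p + ½ * p ≡ p
½+½ = solve 1 (λ p → con ½ :* p :+ con ½ :* p := p) refl
  where open +-*-Solver

½-pos : ∀ {p} → 0ℚ < p → 0ℚ < ½ * p
½-pos = *-pos 0<½

∣-∣-swap : ∀ p q → ∣ p - q ∣ ≡ ∣ q - p ∣
∣-∣-swap p q = trans (sym (∣-p∣≡∣p∣ (p - q))) (cong ∣_∣ (lemma p q))
  where
  open +-*-Solver
  lemma : ∀ p q → - (p - q) ≡ q - p
  lemma = solve 2 (λ p q → :- (p :- q) := q :- p) refl

∣-∣-triangle : ∀ p q r → ∣ p - r ∣ ≤ ∣ p - q ∣ + ∣ q - r ∣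
∣-∣-triangle p q r = subst (λ z → ∣ z ∣ ≤ ∣ p - q ∣ + ∣ q - r ∣) (lemma p q r) (∣p+q∣≤∣p∣+∣q∣ (p - q) (q - r))
  where
  open +-*-Solver
  lemma : ∀ p q r → (p - q) + (q - r) ≡ p - r
  lemma = solve 3 (λ p q r → (p :- q) :+ (q :- r) := p :- r) refl

p≤∣p∣ : ∀ p → p ≤ ∣ p ∣
p≤∣p∣ p with ∣p∣≡p∨∣p∣≡-p p
... | inj₁ eq = ≤-reflexive (sym eq)
... | inj₂ eq = ≤-trans (subst (_≤ 0ℚ) (neg-neg p) (neg-antimono-≤ (subst (0ℚ ≤_) eq (0≤∣p∣ p)))) (0≤∣p∣ p)
  where
  open +-*-Solver
  neg-neg : ∀ p → - (- p) ≡ p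
  neg-neg = solve 1 (λ p → :- (:- p) := p) refl

∣-∣≤ : ∀ {p q} → p ≤ q → - p ≤ q → ∣ p ∣ ≤ q
∣-∣≤ {p} {q} p≤q -p≤q with ∣p∣≡p∨∣p∣≡-p p
... | inj₁ eq = subst (_≤ q) (sym eq) p≤q
... | inj₂ eq = subst (_≤ q) (sym eq) -p≤q

≤⇒-≤ : ∀ {p q r} → p ≤ q + r → p - q ≤ r
≤⇒-≤ {p} {q} {r} h = subst (p - q ≤_) (lemma q r) (+-monoˡ-≤ (- q) h)
  where
  open +-*-Solver
  lemma : ∀ q r → q + r - q ≡ r
  lemma = solve 2 (λ q r → q :+ r :- q := r) refl

-≤⇒≤ : ∀ {p q r} → p - q ≤ r → p ≤ q + r
-≤⇒≤ {p} {q} {r} h = subst (_≤ q + r) (lemma p q) (+-monoʳ-≤ q h)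
  where
  open +-*-Solver
  lemma : ∀ p q → q + (p - q) ≡ p
  lemma = solve 2 (λ p q → q :+ (p :- q) := p) refl

-- Cauchy sequences of rationals; equality of reals is _≃ᴿ_.
record ℝ : Set where
  no-eta-equality
  field
    seq    : ℕ → ℚ
    cauchy : ∀ ε → 0ℚ < ε → ∃[ N ] (∀ m n → N ℕ.≤ m → N ℕ.≤ n → ∣ seq m - seq n ∣ ≤ ε)

open ℝ public

infix  4 _≃ᴿ_ _≤ᴿ_ _<ᴿ_
infixl 6 _+ᴿ_ _-ᴿ_
infixl 7 _*ᴿ_
infix  8 -ᴿ_

_≃ᴿ_ : ℝ → ℝ → Set
x ≃ᴿ y = ∀ ε → 0ℚ < ε → ∃[ N ] (∀ n → N ℕ.≤ n → ∣ seq x n - seq y n ∣ ≤ ε)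

_≤ᴿ_ : ℝ → ℝ → Set
x ≤ᴿ y = ∀ ε → 0ℚ < ε → ∃[ N ] (∀ n → N ℕ.≤ n → seq x n ≤ seq y n + ε)

_<ᴿ_ : ℝ → ℝ → Set
x <ᴿ y = ∃[ ε ] (0ℚ < ε × ∃[ N ] (∀ n → N ℕ.≤ n → seq x n + ε ≤ seq y n))

fromℚ : ℚ → ℝ
seq (fromℚ q) _ = q
cauchy (fromℚ q) ε 0<ε = 0 , λ _ _ _ _ → subst (_≤ ε) (sym (cong ∣_∣ (+-inverseʳ q))) (<⇒≤ 0<ε)

0ᴿ 1ᴿ : ℝ
0ᴿ = fromℚ 0ℚ
1ᴿ = fromℚ 1ℚ

_+ᴿ_ : ℝ → ℝ → ℝ
seq (x +ᴿ y) n = seq x n + seq y n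
cauchy (x +ᴿ y) ε 0<ε =
  let N₁ , h₁ = cauchy x (½ * ε) (½-pos 0<ε)
      N₂ , h₂ = cauchy y (½ * ε) (½-pos 0<ε)
  in N₁ ℕ.⊔ N₂ , λ m n N≤m N≤n → begin
    ∣ (seq x m + seq y m) - (seq x n + seq y n) ∣
      ≡⟨ cong ∣_∣ (lemma (seq x m) (seq y m) (seq x n) (seq y n)) ⟩
    ∣ (seq x m - seq x n) + (seq y m - seq y n) ∣
      ≤⟨ ∣p+q∣≤∣p∣+∣q∣ (seq x m - seq x n) (seq y m - seq y n) ⟩
    ∣ seq x m - seq x n ∣ + ∣ seq y m - seq y n ∣
      ≤⟨ +-mono-≤ (h₁ m n (ℕ.m⊔n≤o⇒m≤o N₁ N₂ N≤m) (ℕ.m⊔n≤o⇒m≤o N₁ N₂ N≤n))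
                  (h₂ m n (ℕ.m⊔n≤o⇒n≤o N₁ N₂ N≤m) (ℕ.m⊔n≤o⇒n≤o N₁ N₂ N≤n)) ⟩
    ½ * ε + ½ * ε
      ≡⟨ ½+½ ε ⟩
    ε ∎
  where
  open ≤-Reasoning
  open +-*-Solver
  lemma : ∀ a b c d → (a + b) - (c + d) ≡ (a - c) + (b - d)
  lemma = solve 4 (λ a b c d → (a :+ b) :- (c :+ d) := (a :- c) :+ (b :- d)) refl

-ᴿ_ : ℝ → ℝ
seq (-ᴿ x) n = - seq x n
cauchy (-ᴿ x) ε 0<ε =
  let N , h = cauchy x ε 0<ε
  in N , λ m n N≤m N≤n → subst (_≤ ε) (lemma (seq x m) (seq x n)) (h m n N≤m N≤n)
  where
  open +-*-Solver
  lemma′ : ∀ a b → a - b ≡ - (- a - - b)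
  lemma′ = solve 2 (λ a b → a :- b := :- (:- a :- :- b)) refl
  lemma : ∀ a b → ∣ a - b ∣ ≡ ∣ - a - - b ∣
  lemma a b = trans (cong ∣_∣ (lemma′ a b)) (∣-p∣≡∣p∣ (- a - - b))

_-ᴿ_ : ℝ → ℝ → ℝ
x -ᴿ y = x +ᴿ (-ᴿ y)

∣_∣ᴿ : ℝ → ℝ
seq ∣ x ∣ᴿ n = ∣ seq x n ∣
cauchy ∣ x ∣ᴿ ε 0<ε =
  let N , h = cauchy x ε 0<ε
  in N , λ m n N≤m N≤n → ≤-trans (lemma (seq x m) (seq x n)) (h m n N≤m N≤n)
  where
  half : ∀ p q → ∣ p ∣ - ∣ q ∣ ≤ ∣ p - q ∣
  half p q = ≤⇒-≤ (subst (λ z → ∣ z ∣ ≤ ∣ q ∣ + ∣ p - q ∣) (eq p q) (∣p+q∣≤∣p∣+∣q∣ q (p - q)))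
    where
    open +-*-Solver
    eq : ∀ p q → q + (p - q) ≡ p
    eq = solve 2 (λ p q → q :+ (p :- q) := p) refl
  neg-sub : ∀ p q → q - p ≡ - (p - q)
  neg-sub = solve 2 (λ p q → q :- p := :- (p :- q)) refl
    where open +-*-Solver
  lemma : ∀ p q → ∣ ∣ p ∣ - ∣ q ∣ ∣ ≤ ∣ p - q ∣
  lemma p q = ∣-∣≤ (half p q) (subst₂ _≤_ (neg-sub ∣ p ∣ ∣ q ∣) (∣-∣-swap q p) (half q p))

bounded-upto : (f : ℕ → ℚ) (N : ℕ) → ∃[ b ] (∀ n → n ℕ.≤ N → ∣ f n ∣ ≤ ι b)
bounded-upto f zero = ℤ.∣ ↥ f 0 ∣ , λ where .0 z≤n → ∣-∣≤ι (f 0)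
bounded-upto f (suc N) with b , h ← bounded-upto f N = b ℕ.+ c , bound
  where
  c = ℤ.∣ ↥ f (suc N) ∣
  bound : ∀ n → n ℕ.≤ suc N → ∣ f n ∣ ≤ ι (b ℕ.+ c)
  bound n n≤ with ℕ.m≤n⇒m<n∨m≡n n≤
  ... | inj₁ (s≤s n≤N) = ≤-trans (h n n≤N) (ι-mono (ℕ.m≤m+n b c))
  ... | inj₂ refl = ≤-trans (∣-∣≤ι (f (suc N))) (ι-mono (ℕ.m≤n+m c b))

bounded : (x : ℝ) → ∃[ b ] (∀ n → ∣ seq x n ∣ ≤ ι b)
bounded x with N , h ← cauchy x (ι 1) (subst (0ℚ <_) (sym ι-1) 0<1) with b , hb ← bounded-upto (seq x) N = b ℕ.+ 1 , bound
  where
  open +-*-Solver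
  eq : ∀ p q → q + (p - q) ≡ p
  eq = solve 2 (λ p q → q :+ (p :- q) := p) refl
  bound : ∀ n → ∣ seq x n ∣ ≤ ι (b ℕ.+ 1)
  bound n with ℕ.≤-total n N
  ... | inj₁ n≤N = ≤-trans (hb n n≤N) (ι-mono (ℕ.m≤m+n b 1))
  ... | inj₂ N≤n = begin
    ∣ seq x n ∣                           ≡⟨ cong ∣_∣ (eq (seq x n) (seq x N)) ⟨
    ∣ seq x N + (seq x n - seq x N) ∣     ≤⟨ ∣p+q∣≤∣p∣+∣q∣ (seq x N) (seq x n - seq x N) ⟩
    ∣ seq x N ∣ + ∣ seq x n - seq x N ∣   ≤⟨ +-mono-≤ (hb N ℕ.≤-refl) (h n N N≤n ℕ.≤-refl) ⟩
    ι b + ι 1                             ≡⟨ ι-+ b 1 ⟨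
    ι (b ℕ.+ 1)                           ∎
    where open ≤-Reasoning

_*ᴿ_ : ℝ → ℝ → ℝ
seq (x *ᴿ y) n = seq x n * seq y n
cauchy (x *ᴿ y) ε 0<ε =
  let bx , hx = bounded x
      by , hy = bounded y
      b = bx ℕ.+ by
      η = δ b * (½ * ε)
      0<η = *-pos (0<δ b) (½-pos 0<ε)
      N₁ , h₁ = cauchy x η 0<η
      N₂ , h₂ = cauchy y η 0<η
      bx≤ = ι-mono (ℕ.≤-trans (ℕ.m≤m+n bx by) (ℕ.n≤1+n b))
      by≤ = ι-mono (ℕ.≤-trans (ℕ.m≤n+m by bx) (ℕ.n≤1+n b))
  in N₁ ℕ.⊔ N₂ , λ m n N≤m N≤n → begin
    ∣ seq x m * seq y m - seq x n * seq y n ∣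
      ≡⟨ cong ∣_∣ (lemma (seq x m) (seq y m) (seq x n) (seq y n)) ⟩
    ∣ seq x m * (seq y m - seq y n) + seq y n * (seq x m - seq x n) ∣
      ≤⟨ ∣p+q∣≤∣p∣+∣q∣ (seq x m * (seq y m - seq y n)) (seq y n * (seq x m - seq x n)) ⟩
    ∣ seq x m * (seq y m - seq y n) ∣ + ∣ seq y n * (seq x m - seq x n) ∣
      ≡⟨ cong₂ _+_ (∣p*q∣≡∣p∣*∣q∣ (seq x m) (seq y m - seq y n)) (∣p*q∣≡∣p∣*∣q∣ (seq y n) (seq x m - seq x n)) ⟩
    ∣ seq x m ∣ * ∣ seq y m - seq y n ∣ + ∣ seq y n ∣ * ∣ seq x m - seq x n ∣
      ≤⟨ +-mono-≤
           (*-mono (0≤∣p∣ (seq x m)) (≤-trans (hx m) bx≤) (0≤∣p∣ (seq y m - seq y n))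
             (h₂ m n (ℕ.m⊔n≤o⇒n≤o N₁ N₂ N≤m) (ℕ.m⊔n≤o⇒n≤o N₁ N₂ N≤n)))
           (*-mono (0≤∣p∣ (seq y n)) (≤-trans (hy n) by≤) (0≤∣p∣ (seq x m - seq x n))
             (h₁ m n (ℕ.m⊔n≤o⇒m≤o N₁ N₂ N≤m) (ℕ.m⊔n≤o⇒m≤o N₁ N₂ N≤n))) ⟩
    ι (suc b) * η + ι (suc b) * η
      ≡⟨ factor (ι (suc b)) (δ b) ε ⟩
    δ b * ι (suc b) * ε
      ≡⟨ cong (_* ε) (δ-inv b) ⟩
    1ℚ * ε
      ≡⟨ *-identityˡ ε ⟩
    ε ∎
  where
  open ≤-Reasoning
  open +-*-Solver
  lemma : ∀ a b c d → a * b - c * d ≡ a * (b - d) + d * (a - c)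
  lemma = solve 4 (λ a b c d → a :* b :- c :* d := a :* (b :- d) :+ d :* (a :- c)) refl
  factor : ∀ B d e → B * (d * (½ * e)) + B * (d * (½ * e)) ≡ d * B * e
  factor = solve 3 (λ B d e → B :* (d :* (con ½ :* e)) :+ B :* (d :* (con ½ :* e)) := d :* B :* e) refl

sq : ℚ → ℚ
sq p = p * p

sq-mono : ∀ {p q} → 0ℚ ≤ p → p ≤ q → sq p ≤ sq q
sq-mono 0≤p p≤q = *-mono 0≤p p≤q 0≤p p≤q

opaque
  pick : ∀ {A : Set} → Dec A → ℕ → ℕ → ℕ
  pick (yes _) m n = m
  pick (no  _) m n = n

  pick-elim : ∀ {A : Set} (P : ℕ → Set) (A? : Dec A) {m n} → (A → P m) → (¬ A → P n) → P (pick A? m n)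
  pick-elim P (yes a) f g = f a
  pick-elim P (no ¬a) f g = g ¬a

  -- The largest k ≤ f with (k/(d+1))² ≤ q, or 0 if there is none.
  rootℕ : ℚ → ℕ → ℕ → ℕ
  rootℕ q d zero = 0
  rootℕ q d (suc f) = pick (sq (ι (suc f) * δ d) ≤? q) (suc f) (rootℕ q d f)

  root : ℚ → ℕ → ℚ
  root q d = ι (rootℕ q d (suc d ℕ.* suc ℤ.∣ ↥ q ∣)) * δ d

  0≤root : ∀ q d → 0ℚ ≤ root q d
  0≤root q d = *-nonneg (0≤ι (rootℕ q d (suc d ℕ.* suc ℤ.∣ ↥ q ∣))) (0≤δ d)

  root-lower : ∀ q d → root q d ≡ 0ℚ ⊎ sq (root q d) ≤ q
  root-lower q d = go (suc d ℕ.* suc ℤ.∣ ↥ q ∣)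
    where
    go : ∀ f → ι (rootℕ q d f) * δ d ≡ 0ℚ ⊎ sq (ι (rootℕ q d f) * δ d) ≤ q
    go zero = inj₁ (trans (cong (_* δ d) ι-0) (*-zeroˡ (δ d)))
    go (suc f) = pick-elim (λ k → ι k * δ d ≡ 0ℚ ⊎ sq (ι k * δ d) ≤ q)
      (sq (ι (suc f) * δ d) ≤? q) inj₂ (λ _ → go f)

  root-upper : ∀ q d → q < sq (root q d + δ d)
  root-upper q d = subst (λ z → q < sq z) (suc-δ (rootℕ q d F)) (go F initial)
    where
    c F : ℕ
    c = ℤ.∣ ↥ q ∣
    F = suc d ℕ.* suc c
    suc-δ : ∀ k → ι (suc k) * δ d ≡ ι k * δ d + δ d
    suc-δ k = trans (cong (_* δ d) (trans (ι-+ 1 k) (+-comm (ι 1) (ι k))))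
      (trans (*-distribʳ-+ (δ d) (ι k) (ι 1)) (cong (_+_ (ι k * δ d)) (trans (cong (_* δ d) ι-1) (*-identityˡ (δ d)))))
    go : ∀ f → q < sq (ι (suc f) * δ d) → q < sq (ι (suc (rootℕ q d f)) * δ d)
    go zero h = h
    go (suc f) h = pick-elim (λ k → q < sq (ι (suc k) * δ d))
      (sq (ι (suc f) * δ d) ≤? q) (λ _ → h) (λ ¬p → go f (≰⇒> ¬p))
    open +-*-Solver
    rearr : ∀ a b e → a * b * e ≡ e * a * b
    rearr = solve 3 (λ a b e → a :* b :* e := e :* a :* b) refl
    cancel : ι F * δ d ≡ ι (suc c)
    cancel = trans (cong (_* δ d) (ι-* (suc d) (suc c)))
      (trans (rearr (ι (suc d)) (ι (suc c)) (δ d))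
      (trans (cong (_* ι (suc c)) (δ-inv d)) (*-identityˡ (ι (suc c)))))
    open ≤-Reasoning
    initial : q < sq (ι (suc F) * δ d)
    initial = begin-strict
      q                        ≤⟨ p≤∣p∣ q ⟩
      ∣ q ∣                    ≤⟨ ∣-∣≤ι q ⟩
      ι c                      <⟨ ι-mono-< (ℕ.n<1+n c) ⟩
      ι (suc c)                ≡⟨ *-identityˡ (ι (suc c)) ⟨
      1ℚ * ι (suc c)           ≤⟨ *-mono 0≤1 (1≤ι c) (0≤ι (suc c)) ≤-refl ⟩
      sq (ι (suc c))           ≡⟨ cong sq cancel ⟨
      sq (ι F * δ d)           ≤⟨ sq-mono (*-nonneg (0≤ι F) (0≤δ d))
                                    (*-mono (0≤ι F) (ι-mono (ℕ.n≤1+n F)) (0≤δ d) ≤-refl) ⟩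
      sq (ι (suc F) * δ d)     ∎

root-close : ∀ p q m n η → 0ℚ ≤ η → p ≤ q + sq η → root p m ≤ root q n + δ n + η
root-close p q m n η 0≤η p≤ with root-lower p m
... | inj₁ eq = subst (_≤ root q n + δ n + η) (sym eq) (+-mono-≤ (+-mono-≤ (0≤root q n) (0≤δ n)) 0≤η)
... | inj₂ low = ≮⇒≥ λ s+η<r → <-irrefl refl (begin-strict
    sq (root p m)                    ≤⟨ low ⟩
    p                                ≤⟨ p≤ ⟩
    q + sq η                         <⟨ +-monoˡ-< (sq η) (root-upper q n) ⟩
    sq s + sq η                      ≡⟨ +-identityʳ (sq s + sq η) ⟨
    sq s + sq η + 0ℚ                 ≤⟨ +-monoʳ-≤ (sq s + sq η) (+-mono-≤ (*-nonneg 0≤s 0≤η) (*-nonneg 0≤s 0≤η)) ⟩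
    sq s + sq η + (s * η + s * η)    ≡⟨ square s η ⟩
    sq (s + η)                       ≤⟨ sq-mono (+-mono-≤ 0≤s 0≤η) (<⇒≤ s+η<r) ⟩
    sq (root p m)                    ∎)
  where
  open ≤-Reasoning
  s = root q n + δ n
  0≤s : 0ℚ ≤ s
  0≤s = +-mono-≤ (0≤root q n) (0≤δ n)
  open +-*-Solver
  square : ∀ s e → s * s + e * e + (s * e + s * e) ≡ (s + e) * (s + e)
  square = solve 2 (λ s e → s :* s :+ e :* e :+ (s :* e :+ s :* e) := (s :+ e) :* (s :+ e)) refl

-- The nonnegative square root of x ≥ 0, characterised by 0≤√ and √-sq; 0 for x < 0.
√ : ℝ → ℝ
seq (√ x) n = root (seq x n) n
cauchy (√ x) ε 0<ε =
  let η = ½ * ε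
      0<η = ½-pos 0<ε
      N₁ , h₁ = cauchy x (sq η) (*-pos 0<η 0<η)
      N₂ , h₂ = archimedean η 0<η
      half : ∀ m n → N₁ ℕ.⊔ N₂ ℕ.≤ m → N₁ ℕ.⊔ N₂ ℕ.≤ n → root (seq x m) m - root (seq x n) n ≤ ε
      half m n N≤m N≤n = ≤⇒-≤ (begin
        root (seq x m) m
          ≤⟨ root-close (seq x m) (seq x n) m n η (<⇒≤ 0<η)
               (-≤⇒≤ (≤-trans (p≤∣p∣ (seq x m - seq x n))
                 (h₁ m n (ℕ.m⊔n≤o⇒m≤o N₁ N₂ N≤m) (ℕ.m⊔n≤o⇒m≤o N₁ N₂ N≤n)))) ⟩
        root (seq x n) n + δ n + η
          ≤⟨ +-monoˡ-≤ η (+-monoʳ-≤ (root (seq x n) n) (h₂ n (ℕ.m⊔n≤o⇒n≤o N₁ N₂ N≤n))) ⟩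
        root (seq x n) n + η + η
          ≡⟨ trans (+-assoc (root (seq x n) n) η η) (cong (_+_ (root (seq x n) n)) (½+½ ε)) ⟩
        root (seq x n) n + ε ∎)
  in N₁ ℕ.⊔ N₂ , λ m n N≤m N≤n →
    ∣-∣≤ (half m n N≤m N≤n)
         (subst (_≤ ε) (neg-sub (root (seq x m) m) (root (seq x n) n)) (half n m N≤n N≤m))
  where
  open ≤-Reasoning
  open +-*-Solver
  neg-sub : ∀ p q → q - p ≡ - (p - q)
  neg-sub = solve 2 (λ p q → q :- p := :- (p :- q)) refl

0≤√ : ∀ x → 0ᴿ ≤ᴿ √ x
0≤√ x ε 0<ε = 0 , λ n _ → +-mono-≤ (0≤root (seq x n) n) (<⇒≤ 0<ε)

√-sq : ∀ x → 0ᴿ ≤ᴿ x → √ x *ᴿ √ x ≃ᴿ x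
√-sq x 0≤x ε 0<ε =
  let b , hb = bounded (√ x)
      c = b ℕ.+ b
      N₁ , h₁ = archimedean (δ c * ε) (*-pos (0<δ c) 0<ε)
      N₂ , h₂ = 0≤x ε 0<ε
  in N₁ ℕ.⊔ N₂ , λ n N≤n →
    let q = seq x n
        r = root q n
        0≤r = 0≤root q n
        N₁≤n = ℕ.m⊔n≤o⇒m≤o N₁ N₂ N≤n
        r≤ = ≤-trans (p≤∣p∣ r) (hb n)
        above : sq r - q ≤ ε
        above = ≤⇒-≤ (case-lower (root-lower q n) (h₂ n (ℕ.m⊔n≤o⇒n≤o N₁ N₂ N≤n)) 0<ε)
        below : q - sq r ≤ ε
        below = ≤⇒-≤ (begin
          q                                            ≤⟨ <⇒≤ (root-upper q n) ⟩
          sq (r + δ n)                                 ≡⟨ square r (δ n) ⟩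
          sq r + (δ n + r + r) * δ n                   ≤⟨ +-monoʳ-≤ (sq r)
              (*-mono (+-mono-≤ (+-mono-≤ (0≤δ n) 0≤r) 0≤r)
                      (+-mono-≤ (+-mono-≤ (δ≤ι n) r≤) r≤) (0≤δ n) (h₁ n N₁≤n)) ⟩
          sq r + (ι 1 + ι b + ι b) * (δ c * ε)         ≡⟨ cong (λ z → sq r + z * (δ c * ε))
              (sym (trans (ι-+ (suc b) b) (cong (_+ ι b) (ι-+ 1 b)))) ⟩
          sq r + ι (suc c) * (δ c * ε)                 ≡⟨ cong (_+_ (sq r)) (trans (rearr (ι (suc c)) (δ c) ε)
              (trans (cong (_* ε) (δ-inv c)) (*-identityˡ ε))) ⟩
          sq r + ε                                     ∎)
    in ∣-∣≤ above (subst (_≤ ε) (neg-sub (sq r) q) below)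
  where
  open ≤-Reasoning
  open +-*-Solver
  case-lower : ∀ {q r ε} → r ≡ 0ℚ ⊎ sq r ≤ q → 0ℚ ≤ q + ε → 0ℚ < ε → sq r ≤ q + ε
  case-lower {q} {r} {ε} (inj₁ refl) h _ = subst (_≤ q + ε) (sym (*-zeroˡ 0ℚ)) h
  case-lower {q} {r} {ε} (inj₂ le) _ 0<ε = subst (_≤ q + ε) (+-identityʳ (sq r)) (+-mono-≤ le (<⇒≤ 0<ε))
  neg-sub : ∀ p q → q - p ≡ - (p - q)
  neg-sub = solve 2 (λ p q → q :- p := :- (p :- q)) refl
  square : ∀ r d → (r + d) * (r + d) ≡ r * r + (d + r + r) * d
  square = solve 2 (λ r d → (r :+ d) :* (r :+ d) := r :* r :+ (d :+ r :+ r) :* d) refl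
  rearr : ∀ a b e → a * (b * e) ≡ b * a * e
  rearr = solve 3 (λ a b e → a :* (b :* e) := b :* a :* e) refl

infixl 6 _+ᶜ_ _-ᶜ_
infixl 7 _*ᶜ_
infixr 8 _•_

record ℂ : Set where
  no-eta-equality
  constructor _+i_
  field
    re im : ℝ

open ℂ public

0ᶜ 1ᶜ ⅈ : ℂ
0ᶜ = 0ᴿ +i 0ᴿ
1ᶜ = 1ᴿ +i 0ᴿ
ⅈ  = 0ᴿ +i 1ᴿ

_+ᶜ_ _-ᶜ_ _*ᶜ_ : ℂ → ℂ → ℂ
z +ᶜ w = (re z +ᴿ re w) +i (im z +ᴿ im w)
z -ᶜ w = (re z -ᴿ re w) +i (im z -ᴿ im w)
z *ᶜ w = (re z *ᴿ re w -ᴿ im z *ᴿ im w) +i (re z *ᴿ im w +ᴿ im z *ᴿ re w)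

_•_ : ℝ → ℂ → ℂ
r • z = (r *ᴿ re z) +i (r *ᴿ im z)

conj : ℂ → ℂ
conj z = re z +i (-ᴿ im z)

∣_∣² : ℂ → ℝ
∣ z ∣² = re z *ᴿ re z +ᴿ im z *ᴿ im z

∑ᴿ : ∀ {n} → (Fin n → ℝ) → ℝ
∑ᴿ = foldr _+ᴿ_ 0ᴿ

∑ᶜ : ∀ {n} → (Fin n → ℂ) → ℂ
∑ᶜ = foldr _+ᶜ_ 0ᶜ

Vector : ℕ → Set
Vector n = Fin n → ℂ

Matrix : ℕ → Set
Matrix n = Fin n → Fin n → ℂ

𝐞 : ∀ {n} → Fin n → Vector n
𝐞 u v = if does (u Fin.≟ v) then 1ᶜ else 0ᶜ

𝟏 : ∀ {n} → Vector n
𝟏 _ = 1ᶜ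

infixl 6 _-ⱽ_
infixl 7 _∘ⱽ_ _*ⱽ_ _*ᴹ_
infixr 8 _•ⱽ_ _^ᴹ_

_-ⱽ_ : ∀ {n} → Vector n → Vector n → Vector n
(x -ⱽ y) v = x v -ᶜ y v

_•ⱽ_ : ∀ {n} → ℝ → Vector n → Vector n
(r •ⱽ x) v = r • x v

_∘ⱽ_ : ∀ {n} → Vector n → Vector n → Vector n
(x ∘ⱽ y) v = x v *ᶜ y v

‖_‖ : ∀ {n} → Vector n → ℝ
‖ x ‖ = √ (∑ᴿ λ v → ∣ x v ∣²)

1ᴹ : ∀ {n} → Matrix n
1ᴹ = 𝐞

conjᴹ : ∀ {n} → Matrix n → Matrix n
conjᴹ M v w = conj (M v w)

_*ⱽ_ : ∀ {n} → Matrix n → Vector n → Vector n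
(M *ⱽ x) v = ∑ᶜ λ w → M v w *ᶜ x w

_*ᴹ_ : ∀ {n} → Matrix n → Matrix n → Matrix n
(M *ᴹ N) v w = ∑ᶜ λ j → M v j *ᶜ N j w

_^ᴹ_ : ∀ {n} → Matrix n → ℕ → Matrix n
M ^ᴹ zero  = 1ᴹ
M ^ᴹ suc k = M *ᴹ (M ^ᴹ k)

∑< : ℕ → (ℕ → ℝ) → ℝ
∑< zero    a = 0ᴿ
∑< (suc m) a = ∑< m a +ᴿ a m

HasSum : (ℕ → ℝ) → ℝ → Set
HasSum a s = ∀ ε → 0ℚ < ε → ∃[ N ] (∀ m → N ℕ.≤ m → ∣ ∑< m a -ᴿ s ∣ᴿ <ᴿ fromℚ ε)

HasSumᶜ : (ℕ → ℂ) → ℂ → Set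
HasSumᶜ a s = HasSum (λ k → re (a k)) (re s) × HasSum (λ k → im (a k)) (im s)

½^ : ℕ → ℚ
½^ zero    = 1ℚ
½^ (suc k) = ½ * ½^ k

0≤½^ : ∀ k → 0ℚ ≤ ½^ k
0≤½^ zero    = 0≤1
0≤½^ (suc k) = *-nonneg (<⇒≤ 0<½) (0≤½^ k)

ι-½^ : ∀ k → ι (2 ℕ.^ k) * ½^ k ≡ 1ℚ
ι-½^ zero    = trans (*-identityʳ (ι 1)) ι-1
ι-½^ (suc k) = trans (cong (_* (½ * ½^ k)) (trans (ι-* 2 (2 ℕ.^ k)) (cong (_* ι (2 ℕ.^ k)) ι-2))) (trans (lemma (ι (2 ℕ.^ k)) (½^ k)) (ι-½^ k))
  where
  open +-*-Solver
  lemma : ∀ a b → (1ℚ + 1ℚ) * a * (½ * b) ≡ a * b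
  lemma = solve 2 (λ a b → con (1ℚ + 1ℚ) :* a :* (con ½ :* b) := a :* b) refl

½^≤δ : ∀ k → ½^ k ≤ δ k
½^≤δ k = begin
  ½^ k                        ≡⟨ *-identityˡ (½^ k) ⟨
  1ℚ * ½^ k                   ≡⟨ cong (_* ½^ k) (δ-inv k) ⟨
  δ k * ι (suc k) * ½^ k      ≤⟨ *-mono (*-nonneg (0≤δ k) (0≤ι (suc k)))
                                   (*-mono (0≤δ k) ≤-refl (0≤ι (suc k)) (ι-mono (k<2^k k))) (0≤½^ k) ≤-refl ⟩
  δ k * ι (2 ℕ.^ k) * ½^ k    ≡⟨ *-assoc (δ k) (ι (2 ℕ.^ k)) (½^ k) ⟩
  δ k * (ι (2 ℕ.^ k) * ½^ k)  ≡⟨ cong (δ k *_) (ι-½^ k) ⟩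
  δ k * 1ℚ                    ≡⟨ *-identityʳ (δ k) ⟩
  δ k                         ∎
  where
  open ≤-Reasoning
  k<2^k : ∀ k → suc k ℕ.≤ 2 ℕ.^ k
  k<2^k zero    = s≤s z≤n
  k<2^k (suc k) = ℕ.≤-trans (ℕ.+-mono-≤ (ℕ.m^n>0 2 k) (k<2^k k))
    (ℕ.≤-reflexive (cong (2 ℕ.^ k ℕ.+_) (sym (ℕ.+-identityʳ (2 ℕ.^ k)))))

-- A series whose representing sequences satisfy a common geometric bound
-- converges to the diagonal sequence of its partial sums.
module Geometric (a : ℕ → ℝ) (K : ℕ) (bound : ∀ k n → ∣ seq (a k) n ∣ ≤ ι K * ½^ k) where

  S : ℕ → ℕ → ℚ
  S m n = seq (∑< m a) n

  tail′ : ∀ n T j → ∣ S (j ℕ.+ T) n - S T n ∣ ≤ ι K * (½^ T + ½^ T) - ι K * (½^ (j ℕ.+ T) + ½^ (j ℕ.+ T))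
  tail′ n T zero = ≤-reflexive (trans (cong ∣_∣ (+-inverseʳ (S T n))) (sym (+-inverseʳ (ι K * (½^ T + ½^ T)))))
  tail′ n T (suc j) = begin
    ∣ S (j ℕ.+ T) n + x - S T n ∣
      ≡⟨ cong ∣_∣ (shuffle (S (j ℕ.+ T) n) x (S T n)) ⟩
    ∣ (S (j ℕ.+ T) n - S T n) + x ∣
      ≤⟨ ∣p+q∣≤∣p∣+∣q∣ (S (j ℕ.+ T) n - S T n) x ⟩
    ∣ S (j ℕ.+ T) n - S T n ∣ + ∣ x ∣
      ≤⟨ +-mono-≤ (tail′ n T j) (bound (j ℕ.+ T) n) ⟩
    ι K * (½^ T + ½^ T) - ι K * (h + h) + ι K * h
      ≡⟨ collapse (ι K) (½^ T) h ⟩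
    ι K * (½^ T + ½^ T) - ι K * (½ * h + ½ * h) ∎
    where
    open ≤-Reasoning
    open +-*-Solver
    x = seq (a (j ℕ.+ T)) n
    h = ½^ (j ℕ.+ T)
    shuffle : ∀ p x q → p + x - q ≡ (p - q) + x
    shuffle = solve 3 (λ p x q → p :+ x :- q := (p :- q) :+ x) refl
    collapse : ∀ k t h → k * (t + t) - k * (h + h) + k * h ≡ k * (t + t) - k * (½ * h + ½ * h)
    collapse = solve 3 (λ k t h → k :* (t :+ t) :- k :* (h :+ h) :+ k :* h
      := k :* (t :+ t) :- k :* (con ½ :* h :+ con ½ :* h)) refl

  tail : ∀ n {T m} → T ℕ.≤ m → ∣ S m n - S T n ∣ ≤ ι K * (½^ T + ½^ T)
  tail n {T} {m} T≤m = subst (λ z → ∣ S z n - S T n ∣ ≤ ι K * (½^ T + ½^ T)) (ℕ.m∸n+n≡m T≤m)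
    (≤-trans (tail′ n T (m ℕ.∸ T)) (drop (*-nonneg (0≤ι K) (+-mono-≤ (0≤½^ (m ℕ.∸ T ℕ.+ T)) (0≤½^ (m ℕ.∸ T ℕ.+ T))))))
    where
    drop : ∀ {p q} → 0ℚ ≤ q → p - q ≤ p
    drop {p} {q} 0≤q = subst (p - q ≤_) (+-identityʳ p) (+-monoʳ-≤ p (neg-antimono-≤ 0≤q))

  small : ∀ ε → 0ℚ < ε → ∃[ T ] (∀ n {m} → T ℕ.≤ m → ∣ S m n - S T n ∣ ≤ ε)
  small ε 0<ε with T , h ← archimedean (δ (K ℕ.+ K) * ε) (*-pos (0<δ (K ℕ.+ K)) 0<ε) = T , λ n T≤m → begin
    _                                   ≤⟨ tail n T≤m ⟩
    ι K * (½^ T + ½^ T)                 ≡⟨ double (ι K) (½^ T) ⟩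
    (ι K + ι K) * ½^ T                  ≡⟨ cong (_* ½^ T) (ι-+ K K) ⟨
    ι (K ℕ.+ K) * ½^ T                  ≤⟨ *-mono (0≤ι (K ℕ.+ K)) (ι-mono (ℕ.n≤1+n (K ℕ.+ K)))
                                             (0≤½^ T) (≤-trans (½^≤δ T) (h T ℕ.≤-refl)) ⟩
    ι (suc (K ℕ.+ K)) * (δ (K ℕ.+ K) * ε)  ≡⟨ rearr (ι (suc (K ℕ.+ K))) (δ (K ℕ.+ K)) ε ⟩
    δ (K ℕ.+ K) * ι (suc (K ℕ.+ K)) * ε ≡⟨ cong (_* ε) (δ-inv (K ℕ.+ K)) ⟩
    1ℚ * ε                              ≡⟨ *-identityˡ ε ⟩
    ε                                   ∎
    where
    open ≤-Reasoning
    open +-*-Solver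
    double : ∀ k t → k * (t + t) ≡ (k + k) * t
    double = solve 2 (λ k t → k :* (t :+ t) := (k :+ k) :* t) refl
    rearr : ∀ a b e → a * (b * e) ≡ b * a * e
    rearr = solve 3 (λ a b e → a :* (b :* e) := b :* a :* e) refl

  sum : ℝ
  seq sum n = S n n
  cauchy sum ε 0<ε =
    let η = ½ * (½ * ε)
        T , h = small η (½-pos (½-pos 0<ε))
        N , c = cauchy (∑< T a) (½ * ε) (½-pos 0<ε)
    in T ℕ.⊔ N , λ m n ≤m ≤n → begin
      ∣ S m m - S n n ∣
        ≤⟨ ∣-∣-triangle (S m m) (S T m) (S n n) ⟩
      ∣ S m m - S T m ∣ + ∣ S T m - S n n ∣
        ≤⟨ +-monoʳ-≤ ∣ S m m - S T m ∣ (∣-∣-triangle (S T m) (S T n) (S n n)) ⟩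
      ∣ S m m - S T m ∣ + (∣ S T m - S T n ∣ + ∣ S T n - S n n ∣)
        ≤⟨ +-mono-≤ (h m (ℕ.m⊔n≤o⇒m≤o T N ≤m)) (+-mono-≤ (c m n (ℕ.m⊔n≤o⇒n≤o T N ≤m) (ℕ.m⊔n≤o⇒n≤o T N ≤n))
             (subst (_≤ η) (∣-∣-swap (S n n) (S T n)) (h n (ℕ.m⊔n≤o⇒m≤o T N ≤n)))) ⟩
      η + (½ * ε + η)
        ≡⟨ total ε ⟩
      ε ∎
    where
    open ≤-Reasoning
    open +-*-Solver
    total : ∀ e → ½ * (½ * e) + (½ * e + ½ * (½ * e)) ≡ e
    total = solve 1 (λ e → con ½ :* (con ½ :* e) :+ (con ½ :* e :+ con ½ :* (con ½ :* e)) := e) refl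

  hasSum : HasSum a sum
  hasSum ε 0<ε =
    let η = ½ * (½ * ε)
        T , h = small η (½-pos (½-pos 0<ε))
    in T , λ m T≤m → ½ * ε , ½-pos 0<ε , T , λ n T≤n → begin
      ∣ S m n - S n n ∣ + ½ * ε
        ≤⟨ +-monoˡ-≤ (½ * ε) (∣-∣-triangle (S m n) (S T n) (S n n)) ⟩
      ∣ S m n - S T n ∣ + ∣ S T n - S n n ∣ + ½ * ε
        ≤⟨ +-monoˡ-≤ (½ * ε) (+-mono-≤ (h n T≤m) (subst (_≤ η) (∣-∣-swap (S n n) (S T n)) (h n T≤n))) ⟩
      η + η + ½ * ε
        ≡⟨ total ε ⟩
      ε ∎
    where
    open ≤-Reasoning
    open +-*-Solver
    total : ∀ e → ½ * (½ * e) + ½ * (½ * e) + ½ * e ≡ e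
    total = solve 1 (λ e → con ½ :* (con ½ :* e) :+ con ½ :* (con ½ :* e) :+ con ½ :* e := e) refl

1/! : ℕ → ℚ
1/! k = (+ 1 / k !) {{k ℕ.!≢0}}

expTerm : ∀ {n} → Matrix n → Fin n → Fin n → ℕ → ℂ
expTerm M v w k = fromℚ (1/! k) • (M ^ᴹ k) v w

module ExpConvergence where

  record Bound (z : ℂ) (b : ℕ) : Set where
    constructor mkBound
    field
      bound-re : ∀ n → ∣ seq (re z) n ∣ ≤ ι b
      bound-im : ∀ n → ∣ seq (im z) n ∣ ≤ ι b

  open Bound

  bound-mono : ∀ {z b c} → b ℕ.≤ c → Bound z b → Bound z c
  bound-mono b≤c (mkBound p q) = mkBound (λ n → ≤-trans (p n) (ι-mono b≤c)) (λ n → ≤-trans (q n) (ι-mono b≤c))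

  bound-of : ∀ z → ∃[ b ] Bound z b
  bound-of z with b , p ← bounded (re z) with c , q ← bounded (im z) =
    b ℕ.+ c , mkBound (λ n → ≤-trans (p n) (ι-mono (ℕ.m≤m+n b c))) (λ n → ≤-trans (q n) (ι-mono (ℕ.m≤n+m c b)))

  sum≤ : ∀ {p q b c} → ∣ p ∣ ≤ ι b → ∣ q ∣ ≤ ι c → ∣ p + q ∣ ≤ ι (b ℕ.+ c)
  sum≤ {p} {q} {b} {c} hp hq = ≤-trans (∣p+q∣≤∣p∣+∣q∣ p q) (subst (_ ≤_) (sym (ι-+ b c)) (+-mono-≤ hp hq))

  diff≤ : ∀ {p q b c} → ∣ p ∣ ≤ ι b → ∣ q ∣ ≤ ι c → ∣ p - q ∣ ≤ ι (b ℕ.+ c)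
  diff≤ {p} {q} {b} {c} hp hq = sum≤ {p} { - q} {b} {c} hp (subst (_≤ ι c) (sym (∣-p∣≡∣p∣ q)) hq)

  prod≤ : ∀ {p q b c} → ∣ p ∣ ≤ ι b → ∣ q ∣ ≤ ι c → ∣ p * q ∣ ≤ ι (b ℕ.* c)
  prod≤ {p} {q} {b} {c} hp hq = subst₂ _≤_ (sym (∣p*q∣≡∣p∣*∣q∣ p q)) (sym (ι-* b c))
    (*-mono (0≤∣p∣ p) hp (0≤∣p∣ q) hq)

  bound-+ : ∀ {z w b c} → Bound z b → Bound w c → Bound (z +ᶜ w) (b ℕ.+ c)
  bound-+ {z} {w} {b} {c} (mkBound p q) (mkBound r s) = mkBound
    (λ n → sum≤ {seq (re z) n} {seq (re w) n} {b} {c} (p n) (r n))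
    (λ n → sum≤ {seq (im z) n} {seq (im w) n} {b} {c} (q n) (s n))

  bound-* : ∀ {z w b c} → Bound z b → Bound w c → Bound (z *ᶜ w) (b ℕ.* c ℕ.+ b ℕ.* c)
  bound-* {z} {w} {b} {c} (mkBound p q) (mkBound r s) = mkBound
    (λ n → diff≤ {b = b ℕ.* c} {b ℕ.* c} (prod≤ {b = b} {c} (p n) (r n)) (prod≤ {b = b} {c} (q n) (s n)))
    (λ n → sum≤ {b = b ℕ.* c} {b ℕ.* c} (prod≤ {b = b} {c} (p n) (s n)) (prod≤ {b = b} {c} (q n) (r n)))

  bound-∑ : ∀ {n b} (f : Fin n → ℂ) → (∀ i → Bound (f i) b) → Bound (∑ᶜ f) (n ℕ.* b)
  bound-∑ {zero}  f h = mkBound (λ _ → 0≤ι 0) (λ _ → 0≤ι 0)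
  bound-∑ {suc n} f h = bound-+ {f zero} {∑ᶜ (λ i → f (suc i))} (h zero) (bound-∑ (λ i → f (suc i)) (λ i → h (suc i)))

  fin-bound : ∀ {n} (f : Fin n → ℕ) → ∃[ b ] (∀ i → f i ℕ.≤ b)
  fin-bound {zero}  f = 0 , λ ()
  fin-bound {suc n} f with b , h ← fin-bound (λ i → f (suc i)) = f zero ℕ.+ b , λ where
    zero    → ℕ.m≤m+n (f zero) b
    (suc i) → ℕ.≤-trans (h i) (ℕ.m≤n+m b (f zero))

  matrix-bound : ∀ {n} (M : Matrix n) → ∃[ b ] (∀ v w → Bound (M v w) b)
  matrix-bound M =
    let rows = λ v → fin-bound (λ w → proj₁ (bound-of (M v w)))
        b , h = fin-bound (λ v → proj₁ (rows v))
    in b , λ v w → bound-mono (ℕ.≤-trans (proj₂ (rows v) w) (h v)) (proj₂ (bound-of (M v w)))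

  bound-1ᴹ : ∀ {n} (v w : Fin n) → Bound (1ᴹ v w) 1
  bound-1ᴹ v w with v Fin.≟ w
  ... | yes _ = mkBound (λ _ → 1≤ι 0) (λ _ → 0≤ι 1)
  ... | no  _ = mkBound (λ _ → 0≤ι 1) (λ _ → 0≤ι 1)

  power-bound : ∀ {n} (M : Matrix n) → ∃[ C ] (∀ k v w → Bound ((M ^ᴹ k) v w) (suc C ℕ.^ k))
  power-bound {n} M with b , h ← matrix-bound M = C , go
    where
    C = n ℕ.* (b ℕ.+ b)
    step : ∀ n b x → n ℕ.* (b ℕ.* x ℕ.+ b ℕ.* x) ≡ n ℕ.* (b ℕ.+ b) ℕ.* x
    step = ℕSolver.solve-∀
    go : ∀ k v w → Bound ((M ^ᴹ k) v w) (suc C ℕ.^ k)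
    go zero    v w = bound-1ᴹ v w
    go (suc k) v w = bound-mono
      (ℕ.≤-trans (ℕ.≤-reflexive (step n b (suc C ℕ.^ k))) (ℕ.*-monoˡ-≤ (suc C ℕ.^ k) (ℕ.n≤1+n C)))
      (bound-∑ (λ j → M v j *ᶜ (M ^ᴹ k) j w) (λ j → bound-* (h v j) (go k j w)))

  power≤factorial : ∀ d k → suc d ℕ.^ k ℕ.≤ suc d ℕ.^ suc d ℕ.* k !
  power≤factorial d zero = ℕ.≤-trans (ℕ.m^n>0 (suc d) (suc d)) (ℕ.≤-reflexive (sym (ℕ.*-identityʳ (suc d ℕ.^ suc d))))
  power≤factorial d (suc k) with ℕ.≤-total (suc k) (suc d)
  ... | inj₁ k≤d = ℕ.≤-trans (ℕ.^-monoʳ-≤ (suc d) k≤d) (ℕ.m≤m*n (suc d ℕ.^ suc d) (suc k !) {{suc k ℕ.!≢0}})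
  ... | inj₂ d≤k = ℕ.≤-trans (ℕ.*-mono-≤ d≤k (power≤factorial d k))
    (ℕ.≤-reflexive (swap (suc k) (suc d ℕ.^ suc d) (k !)))
    where
    swap : ∀ a b c → a ℕ.* (b ℕ.* c) ≡ b ℕ.* (a ℕ.* c)
    swap = ℕSolver.solve-∀

  1/!-inv : ∀ k → 1/! k * ι (k !) ≡ 1ℚ
  1/!-inv k = go (k !) {{k ℕ.!≢0}}
    where
    go : ∀ m .{{_ : ℕ.NonZero m}} → (+ 1 / m) * ι m ≡ 1ℚ
    go (suc m) = trans (cong (_* ι (suc m)) (+1/ m)) (δ-inv m)

  0≤1/! : ∀ k → 0ℚ ≤ 1/! k
  0≤1/! k = nonNegative⁻¹ (1/! k) {{normalize-nonNeg 1 (k !) {{k ℕ.!≢0}}}}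

  factorial-bound : ∀ C k → 1/! k * ι (suc C ℕ.^ k) ≤ ι ((2 ℕ.* suc C) ℕ.^ (2 ℕ.* suc C)) * ½^ k
  factorial-bound C k = begin
    1/! k * ι (suc C ℕ.^ k)
      ≡⟨ *-identityʳ (1/! k * ι (suc C ℕ.^ k)) ⟨
    1/! k * ι (suc C ℕ.^ k) * 1ℚ
      ≡⟨ cong (_*_ (1/! k * ι (suc C ℕ.^ k))) (ι-½^ k) ⟨
    1/! k * ι (suc C ℕ.^ k) * (ι (2 ℕ.^ k) * ½^ k)
      ≡⟨ rearr₁ (1/! k) (ι (suc C ℕ.^ k)) (ι (2 ℕ.^ k)) (½^ k) ⟩
    1/! k * (ι (2 ℕ.^ k) * ι (suc C ℕ.^ k)) * ½^ k
      ≡⟨ cong (λ z → 1/! k * z * ½^ k) (trans (sym (ι-* (2 ℕ.^ k) (suc C ℕ.^ k))) (cong ι (sym (^-* 2 (suc C) k)))) ⟩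
    1/! k * ι (D ℕ.^ k) * ½^ k
      ≤⟨ *-mono (*-nonneg (0≤1/! k) (0≤ι (D ℕ.^ k)))
           (*-mono (0≤1/! k) ≤-refl (0≤ι (D ℕ.^ k)) (ι-mono (power≤factorial (C ℕ.+ suc (C ℕ.+ 0)) k))) (0≤½^ k) ≤-refl ⟩
    1/! k * ι (D ℕ.^ D ℕ.* k !) * ½^ k
      ≡⟨ cong (λ z → 1/! k * z * ½^ k) (ι-* (D ℕ.^ D) (k !)) ⟩
    1/! k * (ι (D ℕ.^ D) * ι (k !)) * ½^ k
      ≡⟨ rearr₂ (1/! k) (ι (D ℕ.^ D)) (ι (k !)) (½^ k) ⟩
    1/! k * ι (k !) * (ι (D ℕ.^ D) * ½^ k)
      ≡⟨ cong (_* (ι (D ℕ.^ D) * ½^ k)) (1/!-inv k) ⟩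
    1ℚ * (ι (D ℕ.^ D) * ½^ k)
      ≡⟨ *-identityˡ (ι (D ℕ.^ D) * ½^ k) ⟩
    ι (D ℕ.^ D) * ½^ k ∎
    where
    open ≤-Reasoning
    open +-*-Solver
    D = 2 ℕ.* suc C
    ^-* : ∀ a b k → (a ℕ.* b) ℕ.^ k ≡ a ℕ.^ k ℕ.* b ℕ.^ k
    ^-* a b zero    = refl
    ^-* a b (suc k) = trans (cong ((a ℕ.* b) ℕ.*_) (^-* a b k)) (inter a b (a ℕ.^ k) (b ℕ.^ k))
      where
      inter : ∀ a b c d → a ℕ.* b ℕ.* (c ℕ.* d) ≡ a ℕ.* c ℕ.* (b ℕ.* d)
      inter = ℕSolver.solve-∀
    rearr₁ : ∀ a b c d → a * b * (c * d) ≡ a * (c * b) * d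
    rearr₁ = solve 4 (λ a b c d → a :* b :* (c :* d) := a :* (c :* b) :* d) refl
    rearr₂ : ∀ a b c d → a * (b * c) * d ≡ a * c * (b * d)
    rearr₂ = solve 4 (λ a b c d → a :* (b :* c) :* d := a :* c :* (b :* d)) refl

  term-bound : ∀ {n} (M : Matrix n) → ∃[ K ] (∀ v w k →
      (∀ m → ∣ seq (re (expTerm M v w k)) m ∣ ≤ ι K * ½^ k)
    × (∀ m → ∣ seq (im (expTerm M v w k)) m ∣ ≤ ι K * ½^ k))
  term-bound M with C , h ← power-bound M = (2 ℕ.* suc C) ℕ.^ (2 ℕ.* suc C) , λ v w k →
      (λ m → scale k (seq (re ((M ^ᴹ k) v w)) m) (bound-re (h k v w) m))
    , (λ m → scale k (seq (im ((M ^ᴹ k) v w)) m) (bound-im (h k v w) m))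
    where
    scale : ∀ k p → ∣ p ∣ ≤ ι (suc C ℕ.^ k) → ∣ 1/! k * p ∣ ≤ ι ((2 ℕ.* suc C) ℕ.^ (2 ℕ.* suc C)) * ½^ k
    scale k p hp = ≤-trans
      (subst (_≤ 1/! k * ι (suc C ℕ.^ k))
        (sym (trans (∣p*q∣≡∣p∣*∣q∣ (1/! k) p) (cong (_* ∣ p ∣) (0≤p⇒∣p∣≡p (0≤1/! k)))))
        (*-mono (0≤1/! k) ≤-refl (0≤∣p∣ p) hp))
      (factorial-bound C k)

  module Re {n} (M : Matrix n) (v w : Fin n) = Geometric (λ k → re (expTerm M v w k))
    (proj₁ (term-bound M)) (λ k → proj₁ (proj₂ (term-bound M) v w k))
  module Im {n} (M : Matrix n) (v w : Fin n) = Geometric (λ k → im (expTerm M v w k))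
    (proj₁ (term-bound M)) (λ k → proj₂ (proj₂ (term-bound M) v w k))

exp : ∀ {n} → Matrix n → Matrix n
exp M v w = ExpConvergence.Re.sum M v w +i ExpConvergence.Im.sum M v w

-- The characterisation of exp: it is the entrywise sum of the series Σₖ Mᵏ / k!.
exp-hasSum : ∀ {n} (M : Matrix n) v w → HasSumᶜ (expTerm M v w) (exp M v w)
exp-hasSum M v w = ExpConvergence.Re.hasSum M v w , ExpConvergence.Im.hasSum M v w

record Graph (n : ℕ) : Set₁ where
  field
    _~_       : Rel (Fin n) 0ℓ
    _~?_      : Decidable _~_
    ~-irrefl  : Irreflexive _≡_ _~_
    ~-sym     : Symmetric _~_
    connected : ∀ u v → Star _~_ u v

module _ {n : ℕ} (X : Graph n) where
  open Graph X

  Bipartite : Set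
  Bipartite = Σ[ side ∈ (Fin n → Bool) ] (∀ u v → u ~ v → side u ≢ side v)

  degree : Fin n → ℕ
  degree u = length (filter (u ~?_) (allFin n))

  -- Each edge {u , v} is listed once, as the pair with u < v.
  edges : List (Fin n × Fin n)
  edges = filter (λ (u , v) → (u Fin.<? v) ×-dec (u ~? v)) (cartesianProduct (allFin n) (allFin n))

  #edges : ℕ
  #edges = length edges

  #deg≡2,3mod4 : ℕ
  #deg≡2,3mod4 = length (filter (λ v → (degree v ℕ.% 4 ℕ.≟ 2) ⊎-dec (degree v ℕ.% 4 ℕ.≟ 3)) (allFin n))

  adjacency : Matrix n
  adjacency u v = if does (u ~? v) then 1ᶜ else 0ᶜ

  U : ℝ → Matrix n
  U t = exp λ v w → (ⅈ *ᶜ (t +i 0ᴿ)) *ᶜ adjacency v w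

  LocalεUniformMixing : Fin n → Set
  LocalεUniformMixing u = ∀ (ε : ℝ) → 0ᴿ <ᴿ ε → ∃[ τ ]
    ‖ (U τ *ⱽ 𝐞 u) ∘ⱽ (conjᴹ (U τ) *ⱽ 𝐞 u) -ⱽ fromℚ 1/n •ⱽ 𝟏 ‖ <ᴿ ε
    where
    1/n : ℚ
    1/n = (+ 1 / n) {{Fin.nonZeroIndex u}}

{-# OPTIONS --safe #-}
module Submission where

-- Write x = U(τ)e_u. As X is bipartite, the entries of x are real on the side of u and
-- imaginary on the other side, so y = Re x + Im x satisfies |y_v| = |x_v| and ‖Ay‖ = ‖Ax‖.
-- U(τ) is unitary and commutes with A, hence ‖Ay‖² = ‖Ae_u‖² = deg u. If y_v² is close to
-- 1/n for all v, then n y_v y_w is close to the product of the signs of y_v and y_w, so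
-- n deg u is close to Σ_v s_v², where s_v is the sum of the signs over the neighbours of v.
-- These are integers, so they are equal once the error is below 1. Now s_v ≡ d_v (mod 2)
-- gives s_v² ≡ d_v² (mod 4), that is n deg u ≡ Σ_v d_v² (mod 4), while d² ≡ d + 2[d ≡ 2,3]
-- (mod 4) and Σ_v d_v = 2|E|. A single ε and a single τ suffice, and the conservation law is
-- only needed up to an error for the partial sums of the exponential series over ℚ.

open import Defs
open import Data.Bool.Base using (Bool; true; false; not; if_then_else_)
import Data.Bool.Properties as Bool
open import Data.Fin.Base using (Fin; zero; suc)
import Data.Fin.Properties as Fin
open import Data.List.Base using (length; filter; map; _++_; tabulate; cartesianProduct)
open import Data.List.Properties using (length-++; filter-++; map-tabulate)
open import Data.Nat.Base using (ℕ; zero; suc; z≤n; s≤s; _!)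
open import Data.Product using (_×_; _,_; proj₁; proj₂; ∃-syntax)
open import Data.Sum.Base using (_⊎_; inj₁; inj₂)
open import Function.Base using (_∘_)
open import Relation.Binary.Definitions using (tri<; tri≈; tri>)
open import Relation.Binary.PropositionalEquality
open import Relation.Nullary using (¬_; Dec; yes; no; does; contradiction)
open import Relation.Nullary.Decidable using (_×-dec_; _⊎-dec_)
open import Relation.Unary using (Pred; Decidable)

module _ where
  open import Algebra.Bundles using (CommutativeRing)
  open import Data.Integer.Base using (+_)
  import Data.Nat.Base as ℕ
  import Data.Nat.Properties as ℕ
  open import Data.Rational
  open import Data.Rational.Properties
  open import Data.Rational.Solver using (module +-*-Solver)
  open import Algebra.Properties.Semiring.Sum (CommutativeRing.semiring +-*-commutativeRing)
    using (sum; sum-cong-≗; ∑-comm; ∑-distrib-+; *-distribˡ-sum; *-distribʳ-sum)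
  import Algebra.Properties.Semiring.Sum ℕ.+-*-semiring as ℕSum
  open ExpConvergence using (0≤1/!; 1/!-inv; factorial-bound)

  -- The conservation law is proved in a real form. With B = τA the vector y is (cos B + sin B) e_u,
  -- so Ay = (cos B + sin B) A e_u, and (cos B + sin B)² = 1 + sin 2B. As sin is odd and A e_u lives
  -- on one side of the bipartition, the term ⟨A e_u , sin(2B) A e_u⟩ vanishes and ‖A e_u‖² remains.
  -- This is a statement about a Cauchy product of scalar power series, paired with the moments ⟨x ,
  -- B^m x⟩. For partial sums with N terms the product runs over the square j, k < N. The triangle j
  -- + k < N gives the limit value exactly; only the rest of the square is error. The rational that
  -- stands for τ changes with N as well, so the error constant has to be uniform over all these
  -- approximations. No square root of n is ever formed: the products n y_v y_w are compared with
  -- signs through their squares.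

  p≤p+q : ∀ p {q} → 0ℚ ≤ q → p ≤ p + q
  p≤p+q p {q} 0≤q = subst (_≤ p + q) (+-identityʳ p) (+-monoʳ-≤ p 0≤q)

  -- Finite sums of rationals and geometric tails.

  Σ< : ℕ → (ℕ → ℚ) → ℚ
  Σ< zero    f = 0ℚ
  Σ< (suc m) f = Σ< m f + f m

  Σ<-cong : ∀ m {f g : ℕ → ℚ} → (∀ k → k ℕ.< m → f k ≡ g k) → Σ< m f ≡ Σ< m g
  Σ<-cong zero    h = refl
  Σ<-cong (suc m) h = cong₂ _+_ (Σ<-cong m (λ k k<m → h k (ℕ.m<n⇒m<1+n k<m))) (h m (ℕ.n<1+n m))

  Σ<-distrib-+ : ∀ m (f g : ℕ → ℚ) → Σ< m (λ k → f k + g k) ≡ Σ< m f + Σ< m g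
  Σ<-distrib-+ zero    f g = refl
  Σ<-distrib-+ (suc m) f g = trans (cong (_+ (f m + g m)) (Σ<-distrib-+ m f g)) (swap (Σ< m f) (Σ< m g) (f m) (g m))
    where
    open +-*-Solver
    swap : ∀ a b c d → a + b + (c + d) ≡ a + c + (b + d)
    swap = solve 4 (λ a b c d → a :+ b :+ (c :+ d) := a :+ c :+ (b :+ d)) refl

  *-distribˡ-Σ< : ∀ m c (f : ℕ → ℚ) → c * Σ< m f ≡ Σ< m (λ k → c * f k)
  *-distribˡ-Σ< zero    c f = *-zeroʳ c
  *-distribˡ-Σ< (suc m) c f = trans (*-distribˡ-+ c (Σ< m f) (f m)) (cong (_+ c * f m) (*-distribˡ-Σ< m c f))

  Σ<-zero : ∀ m {f : ℕ → ℚ} → (∀ k → k ℕ.< m → f k ≡ 0ℚ) → Σ< m f ≡ 0ℚ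
  Σ<-zero zero    h = refl
  Σ<-zero (suc m) h = cong₂ _+_ (Σ<-zero m (λ k k<m → h k (ℕ.m<n⇒m<1+n k<m))) (h m (ℕ.n<1+n m))

  sum-zero : ∀ {n} {f : Fin n → ℚ} → (∀ v → f v ≡ 0ℚ) → sum f ≡ 0ℚ
  sum-zero {zero}  h = refl
  sum-zero {suc n} h = cong₂ _+_ (h zero) (sum-zero (λ v → h (suc v)))

  sum-Σ<-comm : ∀ {n} m (f : Fin n → ℕ → ℚ) → sum (λ v → Σ< m (f v)) ≡ Σ< m (λ k → sum (λ v → f v k))
  sum-Σ<-comm {n} zero f = sum-zero {n} λ _ → refl
  sum-Σ<-comm (suc m) f = trans (∑-distrib-+ (λ v → Σ< m (f v)) (λ v → f v m))
    (cong (_+ sum (λ v → f v m)) (sum-Σ<-comm m f))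

  Σ<-square : ∀ m (f : ℕ → ℚ) → Σ< m f * Σ< m f ≡ Σ< m (λ j → Σ< m (λ k → f j * f k))
  Σ<-square m f = begin
    Σ< m f * Σ< m f                       ≡⟨ *-distribˡ-Σ< m (Σ< m f) f ⟩
    Σ< m (λ j → Σ< m f * f j)             ≡⟨ Σ<-cong m (λ j _ → trans (*-comm (Σ< m f) (f j)) (*-distribˡ-Σ< m (f j) f)) ⟩
    Σ< m (λ j → Σ< m (λ k → f j * f k))   ∎
    where open ≡-Reasoning

  ∣Σ<∣≤ : ∀ m {f g : ℕ → ℚ} → (∀ k → k ℕ.< m → ∣ f k ∣ ≤ g k) → ∣ Σ< m f ∣ ≤ Σ< m g
  ∣Σ<∣≤ zero    h = ≤-refl
  ∣Σ<∣≤ (suc m) {f} h = ≤-trans (∣p+q∣≤∣p∣+∣q∣ (Σ< m f) (f m))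
    (+-mono-≤ (∣Σ<∣≤ m (λ k k<m → h k (ℕ.m<n⇒m<1+n k<m))) (h m (ℕ.n<1+n m)))

  ∣sum∣≤ : ∀ {n} {f : Fin n → ℚ} {b} → (∀ v → ∣ f v ∣ ≤ b) → ∣ sum f ∣ ≤ ι n * b
  ∣sum∣≤ {zero}      {b = b} h = ≤-reflexive (sym (trans (cong (_* b) ι-0) (*-zeroˡ b)))
  ∣sum∣≤ {suc n} {f} {b} h = begin
    ∣ f zero + sum (λ v → f (suc v)) ∣       ≤⟨ ∣p+q∣≤∣p∣+∣q∣ (f zero) _ ⟩
    ∣ f zero ∣ + ∣ sum (λ v → f (suc v)) ∣   ≤⟨ +-mono-≤ (h zero) (∣sum∣≤ (λ v → h (suc v))) ⟩
    b + ι n * b                              ≡⟨ cong (_+ ι n * b) (*-identityˡ b) ⟨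
    1ℚ * b + ι n * b                         ≡⟨ cong (λ z → z * b + ι n * b) ι-1 ⟨
    ι 1 * b + ι n * b                        ≡⟨ *-distribʳ-+ b (ι 1) (ι n) ⟨
    (ι 1 + ι n) * b                          ≡⟨ cong (_* b) (ι-+ 1 n) ⟨
    ι (suc n) * b                            ∎
    where open ≤-Reasoning

  Σ<-½^ : ∀ m → Σ< m ½^ ≤ 1ℚ + 1ℚ
  Σ<-½^ m = ≤-trans (p≤p+q (Σ< m ½^) (+-mono-≤ (0≤½^ m) (0≤½^ m)))
    (≤-reflexive (go m))
    where
    open +-*-Solver
    step : ∀ s h → s + h + (½ * h + ½ * h) ≡ s + (h + h)
    step = solve 2 (λ s h → s :+ h :+ (con ½ :* h :+ con ½ :* h) := s :+ (h :+ h)) refl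
    go : ∀ m → Σ< m ½^ + (½^ m + ½^ m) ≡ 1ℚ + 1ℚ
    go zero    = refl
    go (suc m) = trans (step (Σ< m ½^) (½^ m)) (go m)

  ∣Σ<-Σ<∣≤ : ∀ {f : ℕ → ℚ} {b} → 0ℚ ≤ b → (∀ k → ∣ f k ∣ ≤ b * ½^ k) →
    ∀ {m m′} → m ℕ.≤ m′ → ∣ Σ< m′ f - Σ< m f ∣ ≤ b * (½^ m + ½^ m)
  ∣Σ<-Σ<∣≤ {f} {b} 0≤b h {m} {m′} m≤m′ = ≤-trans
    (p≤p+q ∣ Σ< m′ f - Σ< m f ∣ (*-nonneg 0≤b (+-mono-≤ (0≤½^ m′) (0≤½^ m′))))
    (go (ℕ.≤⇒≤′ m≤m′))
    where
    open ≤-Reasoning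
    open +-*-Solver
    shuffle : ∀ p x q → p + x - q ≡ (p - q) + x
    shuffle = solve 3 (λ p x q → p :+ x :- q := (p :- q) :+ x) refl
    absorb : ∀ s b h → s + b * h + b * (½ * h + ½ * h) ≡ s + b * (h + h)
    absorb = solve 3 (λ s b h → s :+ b :* h :+ b :* (con ½ :* h :+ con ½ :* h) := s :+ b :* (h :+ h)) refl
    -- The geometric remainder beyond `m′` stays on the left; each new term consumes half of it, and
    -- the induction closes without loss.
    go : ∀ {m′} → m ℕ.≤′ m′ → ∣ Σ< m′ f - Σ< m f ∣ + b * (½^ m′ + ½^ m′) ≤ b * (½^ m + ½^ m)
    go (ℕ.≤′-reflexive refl) = ≤-reflexive (trans (cong (λ z → ∣ z ∣ + b * (½^ m + ½^ m)) (+-inverseʳ (Σ< m f))) (+-identityˡ _))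
    go {suc m′} (ℕ.≤′-step m≤m′) = begin
      ∣ Σ< m′ f + f m′ - Σ< m f ∣ + b * (½ * h′ + ½ * h′)
        ≡⟨ cong (λ z → ∣ z ∣ + b * (½ * h′ + ½ * h′)) (shuffle (Σ< m′ f) (f m′) (Σ< m f)) ⟩
      ∣ (Σ< m′ f - Σ< m f) + f m′ ∣ + b * (½ * h′ + ½ * h′)
        ≤⟨ +-monoˡ-≤ _ (≤-trans (∣p+q∣≤∣p∣+∣q∣ (Σ< m′ f - Σ< m f) (f m′)) (+-monoʳ-≤ ∣ Σ< m′ f - Σ< m f ∣ (h m′))) ⟩
      ∣ Σ< m′ f - Σ< m f ∣ + b * h′ + b * (½ * h′ + ½ * h′)
        ≡⟨ absorb ∣ Σ< m′ f - Σ< m f ∣ b h′ ⟩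
      ∣ Σ< m′ f - Σ< m f ∣ + b * (h′ + h′)
        ≤⟨ go m≤m′ ⟩
      b * (½^ m + ½^ m) ∎
      where h′ = ½^ m′

  ½^-+ : ∀ j k → ½^ (j ℕ.+ k) ≡ ½^ j * ½^ k
  ½^-+ zero    k = sym (*-identityˡ (½^ k))
  ½^-+ (suc j) k = trans (cong (½ *_) (½^-+ j k)) (sym (*-assoc ½ (½^ j) (½^ k)))

  -- Square and triangular partial sums of a Cauchy product.

  square triangle : ℕ → (ℕ → ℕ → ℚ) → ℚ
  square   m F = Σ< m λ j → Σ< m (F j)
  triangle m F = Σ< m λ j → Σ< (m ℕ.∸ j) (F j)

  -- Each row `j` gains its entry on the antidiagonal j + k = m. The row `m` is new, and its older
  -- part is empty.
  triangle-suc : ∀ m F → triangle (suc m) F ≡ triangle m F + Σ< (suc m) (λ j → F j (m ℕ.∸ j))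
  triangle-suc m F = begin
    triangle (suc m) F
      ≡⟨ Σ<-cong (suc m) (λ j j<1+m → cong (λ z → Σ< z (F j)) (ℕ.+-∸-assoc 1 (ℕ.s≤s⁻¹ j<1+m))) ⟩
    Σ< (suc m) (λ j → Σ< (m ℕ.∸ j) (F j) + F j (m ℕ.∸ j))
      ≡⟨ Σ<-distrib-+ (suc m) (λ j → Σ< (m ℕ.∸ j) (F j)) (λ j → F j (m ℕ.∸ j)) ⟩
    triangle m F + Σ< (m ℕ.∸ m) (F m) + Σ< (suc m) (λ j → F j (m ℕ.∸ j))
      ≡⟨ cong (λ z → triangle m F + Σ< z (F m) + Σ< (suc m) (λ j → F j (m ℕ.∸ j))) (ℕ.n∸n≡0 m) ⟩
    triangle m F + 0ℚ + Σ< (suc m) (λ j → F j (m ℕ.∸ j))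
      ≡⟨ cong (_+ Σ< (suc m) (λ j → F j (m ℕ.∸ j))) (+-identityʳ (triangle m F)) ⟩
    triangle m F + Σ< (suc m) (λ j → F j (m ℕ.∸ j)) ∎
    where open ≡-Reasoning

  -- Outside the triangle, row `j` is a geometric tail that starts at `m ∸ j`. One factor `½^ j`
  -- turns its size into a multiple of `½^ m`; the second one keeps the sum over the rows below 2.
  -- This is why the decay asked of `F` is asymmetric.
  square-triangle : ∀ m {F : ℕ → ℕ → ℚ} {b} → 0ℚ ≤ b → (∀ j k → ∣ F j k ∣ ≤ b * ½^ j * ½^ j * ½^ k) →
    ∣ square m F - triangle m F ∣ ≤ (b + b) * ½^ m * (1ℚ + 1ℚ)
  square-triangle m {F} {b} 0≤b h = begin
    ∣ square m F - triangle m F ∣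
      ≡⟨ cong ∣_∣ split ⟩
    ∣ Σ< m (λ j → Σ< m (F j) - Σ< (m ℕ.∸ j) (F j)) ∣
      ≤⟨ ∣Σ<∣≤ m row ⟩
    Σ< m (λ j → (b + b) * ½^ m * ½^ j)
      ≡⟨ *-distribˡ-Σ< m ((b + b) * ½^ m) ½^ ⟨
    (b + b) * ½^ m * Σ< m ½^
      ≤⟨ *-monoˡ-≤-nonNeg ((b + b) * ½^ m) {{nonNegative (*-nonneg (+-mono-≤ 0≤b 0≤b) (0≤½^ m))}} (Σ<-½^ m) ⟩
    (b + b) * ½^ m * (1ℚ + 1ℚ) ∎
    where
    open ≤-Reasoning
    open +-*-Solver
    -1* : ∀ p → - p ≡ (- 1ℚ) * p
    -1* = solve 1 (λ p → :- p := (:- con 1ℚ) :* p) refl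
    split : square m F - triangle m F ≡ Σ< m (λ j → Σ< m (F j) - Σ< (m ℕ.∸ j) (F j))
    split = trans (cong (_+_ (square m F)) (trans (-1* (triangle m F))
        (trans (*-distribˡ-Σ< m (- 1ℚ) _) (Σ<-cong m (λ j _ → sym (-1* _))))))
      (sym (Σ<-distrib-+ m _ _))
    rearr : ∀ b x z → b * x * x * (z + z) ≡ (b + b) * (x * z) * x
    rearr = solve 3 (λ b x z → b :* x :* x :* (z :+ z) := (b :+ b) :* (x :* z) :* x) refl
    row : ∀ j → j ℕ.< m → ∣ Σ< m (F j) - Σ< (m ℕ.∸ j) (F j) ∣ ≤ (b + b) * ½^ m * ½^ j
    row j j<m = begin
      ∣ Σ< m (F j) - Σ< (m ℕ.∸ j) (F j) ∣
        ≤⟨ ∣Σ<-Σ<∣≤ (*-nonneg (*-nonneg 0≤b (0≤½^ j)) (0≤½^ j)) (h j) (ℕ.m∸n≤m m j) ⟩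
      b * ½^ j * ½^ j * (½^ (m ℕ.∸ j) + ½^ (m ℕ.∸ j))
        ≡⟨ rearr b (½^ j) (½^ (m ℕ.∸ j)) ⟩
      (b + b) * (½^ j * ½^ (m ℕ.∸ j)) * ½^ j
        ≡⟨ cong (λ z → (b + b) * z * ½^ j) (trans (sym (½^-+ j (m ℕ.∸ j))) (cong ½^ (ℕ.m+[n∸m]≡n (ℕ.<⇒≤ j<m)))) ⟩
      (b + b) * ½^ m * ½^ j ∎

  -- The power series of cos z + sin z and its square.

  -- γ k and σ k are the real and imaginary parts of iᵏ.
  γ σ ϕ : ℕ → ℚ
  γ zero    = 1ℚ
  γ (suc k) = - σ k
  σ zero    = 0ℚ
  σ (suc k) = γ k
  ϕ k = γ k + σ k

  γ-+ : ∀ j k → γ (j ℕ.+ k) ≡ γ j * γ k - σ j * σ k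
  σ-+ : ∀ j k → σ (j ℕ.+ k) ≡ γ j * σ k + σ j * γ k
  γ-+ zero k = lemma (γ k) (σ k)
    where
    open +-*-Solver
    lemma : ∀ c s → c ≡ 1ℚ * c - 0ℚ * s
    lemma = solve 2 (λ c s → c := con 1ℚ :* c :- con 0ℚ :* s) refl
  γ-+ (suc j) k = trans (cong -_ (σ-+ j k)) (lemma (γ j) (σ j) (γ k) (σ k))
    where
    open +-*-Solver
    lemma : ∀ c s c′ s′ → - (c * s′ + s * c′) ≡ (- s) * c′ - c * s′
    lemma = solve 4 (λ c s c′ s′ → :- (c :* s′ :+ s :* c′) := (:- s) :* c′ :- c :* s′) refl
  σ-+ zero k = lemma (γ k) (σ k)
    where
    open +-*-Solver
    lemma : ∀ c s → s ≡ 1ℚ * s + 0ℚ * c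
    lemma = solve 2 (λ c s → s := con 1ℚ :* s :+ con 0ℚ :* c) refl
  σ-+ (suc j) k = trans (γ-+ j k) (lemma (γ j) (σ j) (γ k) (σ k))
    where
    open +-*-Solver
    lemma : ∀ c s c′ s′ → c * c′ - s * s′ ≡ (- s) * s′ + c * c′
    lemma = solve 4 (λ c s c′ s′ → c :* c′ :- s :* s′ := (:- s) :* s′ :+ c :* c′) refl

  -- By the addition formulas, ϕ j ϕ (k+1) + ϕ (j+1) ϕ k = 2 γ (j+k). So along an antidiagonal of
  -- even index the products of phases alternate in sign.
  ϕ-alternates : ∀ j k → γ (j ℕ.+ k) ≡ 0ℚ → ϕ j * ϕ (suc k) ≡ - (ϕ (suc j) * ϕ k)
  ϕ-alternates j k γ≡0 = trans (lemma (γ j) (σ j) (γ k) (σ k))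
    (trans (cong (λ z → z + z - ϕ (suc j) * ϕ k) (trans (sym (γ-+ j k)) γ≡0)) (+-identityˡ _))
    where
    open +-*-Solver
    lemma : ∀ c s c′ s′ → (c + s) * (- s′ + c′) ≡ (c * c′ - s * s′) + (c * c′ - s * s′) - (- s + c) * (c′ + s′)
    lemma = solve 4 (λ c s c′ s′ → (c :+ s) :* (:- s′ :+ c′)
      := (c :* c′ :- s :* s′) :+ (c :* c′ :- s :* s′) :- (:- s :+ c) :* (c′ :+ s′)) refl

  ∣γ∣≤1 : ∀ k → ∣ γ k ∣ ≤ 1ℚ
  ∣σ∣≤1 : ∀ k → ∣ σ k ∣ ≤ 1ℚ
  ∣γ∣≤1 zero    = ≤-refl
  ∣γ∣≤1 (suc k) = subst (_≤ 1ℚ) (sym (∣-p∣≡∣p∣ (σ k))) (∣σ∣≤1 k)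
  ∣σ∣≤1 zero    = 0≤1
  ∣σ∣≤1 (suc k) = ∣γ∣≤1 k

  -- Taylor coefficients of cos z + sin z. Evaluated at a real matrix B, this series is the sum of
  -- the real and imaginary parts of exp(iB).
  coeff : ℕ → ℚ
  coeff k = 1/! k * ϕ k

  1/!-suc : ∀ k → 1/! k ≡ ι (suc k) * 1/! (suc k)
  1/!-suc k = begin
    1/! k                                            ≡⟨ *-identityˡ (1/! k) ⟨
    1ℚ * 1/! k                                       ≡⟨ cong (_* 1/! k) (1/!-inv (suc k)) ⟨
    1/! (suc k) * ι (suc k !) * 1/! k                ≡⟨ cong (λ z → 1/! (suc k) * z * 1/! k) (ι-* (suc k) (k !)) ⟩
    1/! (suc k) * (ι (suc k) * ι (k !)) * 1/! k      ≡⟨ rearr (1/! (suc k)) (ι (suc k)) (ι (k !)) (1/! k) ⟩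
    ι (suc k) * 1/! (suc k) * (1/! k * ι (k !))      ≡⟨ cong (ι (suc k) * 1/! (suc k) *_) (1/!-inv k) ⟩
    ι (suc k) * 1/! (suc k) * 1ℚ                     ≡⟨ *-identityʳ _ ⟩
    ι (suc k) * 1/! (suc k)                          ∎
    where
    open ≡-Reasoning
    open +-*-Solver
    rearr : ∀ a b c d → a * (b * c) * d ≡ b * a * (d * c)
    rearr = solve 4 (λ a b c d → a :* (b :* c) :* d := b :* a :* (d :* c)) refl

  -- For even m the terms are alternating multiples of binomial coefficients, and this is the closed
  -- form of a truncated alternating sum: Σ_{j ≤ r} (-1)^j C(m,j) = (-1)^r C(m-1,r), divided by
  -- (m-1)!. The induction is Pascal's rule, in the form m = (r+1) + (k+1).
  conv-partial : ∀ m r k → m ≡ suc (r ℕ.+ k) → γ (r ℕ.+ k) ≡ 0ℚ →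
    ι m * Σ< (suc r) (λ j → coeff j * coeff (m ℕ.∸ j)) ≡ 1/! r * 1/! k * (ϕ r * ϕ (suc k))
  conv-partial m zero k refl γ≡0 = trans (lemma (ι (suc k)) (1/! 0) (ϕ 0) (1/! (suc k)) (ϕ (suc k)))
    (cong (λ z → 1/! 0 * z * (ϕ 0 * ϕ (suc k))) (sym (1/!-suc k)))
    where
    open +-*-Solver
    lemma : ∀ i a x b y → i * (0ℚ + a * x * (b * y)) ≡ a * (i * b) * (x * y)
    lemma = solve 5 (λ i a x b y → i :* (con 0ℚ :+ a :* x :* (b :* y)) := a :* (i :* b) :* (x :* y)) refl
  conv-partial m (suc r) k m≡ γ≡0 = begin
    ι m * (Σ< (suc r) t + coeff (suc r) * coeff (m ℕ.∸ suc r))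
      ≡⟨ cong (λ z → ι m * (Σ< (suc r) t + coeff (suc r) * coeff z)) m∸ ⟩
    ι m * (Σ< (suc r) t + coeff (suc r) * coeff (suc k))
      ≡⟨ *-distribˡ-+ (ι m) (Σ< (suc r) t) (coeff (suc r) * coeff (suc k)) ⟩
    ι m * Σ< (suc r) t + ι m * (coeff (suc r) * coeff (suc k))
      ≡⟨ cong₂ _+_ (conv-partial m r (suc k) m≡′ γ≡0′) (cong (_* (coeff (suc r) * coeff (suc k))) ιm) ⟩
    1/! r * X * (ϕ r * ϕ (suc (suc k))) + (ι (suc r) + ι (suc k)) * (coeff (suc r) * coeff (suc k))
      ≡⟨ cong₂ (λ y z → y * X * z + (ι (suc r) + ι (suc k)) * (coeff (suc r) * coeff (suc k)))
           (1/!-suc r) (ϕ-alternates r (suc k) γ≡0′) ⟩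
    ι (suc r) * Y * X * (- (ϕ (suc r) * ϕ (suc k))) + (ι (suc r) + ι (suc k)) * (Y * ϕ (suc r) * (X * ϕ (suc k)))
      ≡⟨ lemma (ι (suc r)) (ι (suc k)) X Y (ϕ (suc r)) (ϕ (suc k)) ⟩
    Y * (ι (suc k) * X) * (ϕ (suc r) * ϕ (suc k))
      ≡⟨ cong (λ z → Y * z * (ϕ (suc r) * ϕ (suc k))) (1/!-suc k) ⟨
    Y * 1/! k * (ϕ (suc r) * ϕ (suc k)) ∎
    where
    open ≡-Reasoning
    open +-*-Solver
    t : ℕ → ℚ
    t j = coeff j * coeff (m ℕ.∸ j)
    X = 1/! (suc k)
    Y = 1/! (suc r)
    m≡′ : m ≡ suc (r ℕ.+ suc k)
    m≡′ = trans m≡ (cong suc (sym (ℕ.+-suc r k)))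
    γ≡0′ : γ (r ℕ.+ suc k) ≡ 0ℚ
    γ≡0′ = trans (cong γ (ℕ.+-suc r k)) γ≡0
    m∸ : m ℕ.∸ suc r ≡ suc k
    m∸ = trans (cong (ℕ._∸ suc r) m≡′) (ℕ.m+n∸m≡n r (suc k))
    ιm : ι m ≡ ι (suc r) + ι (suc k)
    ιm = trans (cong ι m≡′) (ι-+ (suc r) (suc k))
    lemma : ∀ i j x y p q → i * y * x * (- (p * q)) + (i + j) * (y * p * (x * q)) ≡ y * (j * x) * (p * q)
    lemma = solve 6 (λ i j x y p q → i :* y :* x :* (:- (p :* q)) :+ (i :+ j) :* (y :* p :* (x :* q))
      := y :* (j :* x) :* (p :* q)) refl

  -- The even coefficients of (cos z + sin z)² = 1 + sin 2z vanish, except the constant one.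
  conv-vanishes : ∀ p → σ (suc p) ≡ 0ℚ → Σ< (suc (suc p)) (λ j → coeff j * coeff (suc p ℕ.∸ j)) ≡ 0ℚ
  conv-vanishes p γp≡0 = begin
    C                                      ≡⟨ *-identityˡ C ⟨
    1ℚ * C                                 ≡⟨ cong (_* C) (δ-inv p) ⟨
    δ p * ι m * C                          ≡⟨ *-assoc (δ p) (ι m) C ⟩
    δ p * (ι m * C)                        ≡⟨ cong (δ p *_) scaled ⟩
    δ p * 0ℚ                               ≡⟨ *-zeroʳ (δ p) ⟩
    0ℚ                                     ∎
    where
    open ≡-Reasoning
    open +-*-Solver
    m = suc p
    t : ℕ → ℚ
    t j = coeff j * coeff (m ℕ.∸ j)
    C = Σ< (suc m) t
    γ≡0 : γ (p ℕ.+ 0) ≡ 0ℚ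
    γ≡0 = trans (cong γ (ℕ.+-identityʳ p)) γp≡0
    lemma : ∀ i a b x y → i * b * a * (- (x * y)) + i * (b * x * (a * y)) ≡ 0ℚ
    lemma = solve 5 (λ i a b x y → i :* b :* a :* (:- (x :* y)) :+ i :* (b :* x :* (a :* y)) := con 0ℚ) refl
    scaled : ι m * C ≡ 0ℚ
    scaled = begin
      ι m * (Σ< m t + coeff m * coeff (m ℕ.∸ m))
        ≡⟨ cong (λ z → ι m * (Σ< m t + coeff m * coeff z)) (ℕ.n∸n≡0 m) ⟩
      ι m * (Σ< m t + coeff m * coeff 0)
        ≡⟨ *-distribˡ-+ (ι m) (Σ< m t) (coeff m * coeff 0) ⟩
      ι m * Σ< m t + ι m * (coeff m * coeff 0)
        -- The closed form reaches only j = m - 1, where k = 0; the last term j = m is kept apart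
        -- and cancels it.
        ≡⟨ cong (_+ ι m * (coeff m * coeff 0)) (conv-partial m p 0 (cong suc (sym (ℕ.+-identityʳ p))) γ≡0) ⟩
      1/! p * 1/! 0 * (ϕ p * ϕ 1) + ι m * (coeff m * coeff 0)
        ≡⟨ cong₂ (λ y z → y * 1/! 0 * z + ι m * (coeff m * coeff 0)) (1/!-suc p) (ϕ-alternates p 0 γ≡0) ⟩
      ι m * 1/! m * 1/! 0 * (- (ϕ m * ϕ 0)) + ι m * (1/! m * ϕ m * (1/! 0 * ϕ 0))
        ≡⟨ lemma (ι m) (1/! 0) (1/! m) (ϕ m) (ϕ 0) ⟩
      0ℚ ∎

  ½^≤1 : ∀ k → ½^ k ≤ 1ℚ
  ½^≤1 k = ≤-trans (½^≤δ k) (subst (δ k ≤_) ι-1 (δ≤ι k))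

  ^-distribʳ-* : ∀ k m n → (m ℕ.* n) ℕ.^ k ≡ m ℕ.^ k ℕ.* n ℕ.^ k
  ^-distribʳ-* zero    m n = refl
  ^-distribʳ-* (suc k) m n = trans (cong (m ℕ.* n ℕ.*_) (^-distribʳ-* k m n)) (ℕ.[m*n]*[o*p]≡[m*o]*[n*p] m n (m ℕ.^ k) (n ℕ.^ k))

  -- `factorial-bound` is applied to a base above 2D instead of D. The surplus 2^k pays for the
  -- second factor `½^ k`, which the rows of the Cauchy product require.
  1/!-decay : ∀ D → ∃[ K ] (∀ k → 1/! k * ι (D ℕ.^ k) ≤ ι K * ½^ k * ½^ k)
  1/!-decay D = (2 ℕ.* suc C) ℕ.^ (2 ℕ.* suc C) , λ k → begin
    1/! k * ι (D ℕ.^ k)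
      ≡⟨ *-identityʳ _ ⟨
    1/! k * ι (D ℕ.^ k) * 1ℚ
      ≡⟨ cong (1/! k * ι (D ℕ.^ k) *_) (ι-½^ k) ⟨
    1/! k * ι (D ℕ.^ k) * (ι (2 ℕ.^ k) * ½^ k)
      ≡⟨ rearr (1/! k) (ι (D ℕ.^ k)) (ι (2 ℕ.^ k)) (½^ k) ⟩
    1/! k * (ι (D ℕ.^ k) * ι (2 ℕ.^ k)) * ½^ k
      ≡⟨ cong (λ z → 1/! k * z * ½^ k) (trans (cong ι (^-distribʳ-* k D 2)) (ι-* (D ℕ.^ k) (2 ℕ.^ k))) ⟨
    1/! k * ι (C ℕ.^ k) * ½^ k
      ≤⟨ *-mono (*-nonneg (0≤1/! k) (0≤ι (C ℕ.^ k)))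
           (*-mono (0≤1/! k) ≤-refl (0≤ι (C ℕ.^ k)) (ι-mono (ℕ.^-monoˡ-≤ k (ℕ.n≤1+n C)))) (0≤½^ k) ≤-refl ⟩
    1/! k * ι (suc C ℕ.^ k) * ½^ k
      ≤⟨ *-mono (*-nonneg (0≤1/! k) (0≤ι (suc C ℕ.^ k))) (factorial-bound C k) (0≤½^ k) ≤-refl ⟩
    _ ∎
    where
    open ≤-Reasoning
    open +-*-Solver
    C = D ℕ.* 2
    rearr : ∀ a b c d → a * b * (c * d) ≡ a * (b * c) * d
    rearr = solve 4 (λ a b c d → a :* b :* (c :* d) := a :* (b :* c) :* d) refl

  -- Symmetric matrices over ℚ and the energy of a partial sum.

  infixr 8 _·_

  _·_ : ∀ {n} → (Fin n → Fin n → ℚ) → (Fin n → ℚ) → Fin n → ℚ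
  (B · x) v = sum λ w → B v w * x w

  iterate : ∀ {n} → (Fin n → Fin n → ℚ) → ℕ → (Fin n → ℚ) → Fin n → ℚ
  iterate B zero    x = x
  iterate B (suc k) x = B · iterate B k x

  ⟨_,_⟩ : ∀ {n} → (Fin n → ℚ) → (Fin n → ℚ) → ℚ
  ⟨ x , y ⟩ = sum λ v → x v * y v

  ∣coeff∣≤ : ∀ k → ∣ coeff k ∣ ≤ 1/! k * ι 2
  ∣coeff∣≤ k = begin
    ∣ 1/! k * ϕ k ∣       ≡⟨ ∣p*q∣≡∣p∣*∣q∣ (1/! k) (ϕ k) ⟩
    ∣ 1/! k ∣ * ∣ ϕ k ∣   ≡⟨ cong (_* ∣ ϕ k ∣) (0≤p⇒∣p∣≡p (0≤1/! k)) ⟩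
    1/! k * ∣ ϕ k ∣       ≤⟨ *-mono (0≤1/! k) ≤-refl (0≤∣p∣ (ϕ k)) ∣ϕ∣≤2 ⟩
    1/! k * ι 2           ∎
    where
    open ≤-Reasoning
    ∣ϕ∣≤2 : ∣ ϕ k ∣ ≤ ι 2
    ∣ϕ∣≤2 = ≤-trans (∣p+q∣≤∣p∣+∣q∣ (γ k) (σ k)) (subst (∣ γ k ∣ + ∣ σ k ∣ ≤_) (sym ι-2) (+-mono-≤ (∣γ∣≤1 k) (∣σ∣≤1 k)))

  module _ {n} {B : Fin n → Fin n → ℚ} (B-sym : ∀ v w → B v w ≡ B w v) where

    ·-selfAdjoint : ∀ x y → ⟨ B · x , y ⟩ ≡ ⟨ x , B · y ⟩
    ·-selfAdjoint x y = begin
      sum (λ v → sum (λ w → B v w * x w) * y v)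
        ≡⟨ sum-cong-≗ (λ v → *-distribʳ-sum (y v) (λ w → B v w * x w)) ⟩
      sum (λ v → sum (λ w → B v w * x w * y v))
        ≡⟨ ∑-comm (λ v w → B v w * x w * y v) ⟩
      sum (λ w → sum (λ v → B v w * x w * y v))
        ≡⟨ sum-cong-≗ (λ w → sum-cong-≗ (λ v → trans (cong (λ z → z * x w * y v) (B-sym v w)) (rearr (B w v) (x w) (y v)))) ⟩
      sum (λ w → sum (λ v → x w * (B w v * y v)))
        ≡⟨ sum-cong-≗ (λ w → *-distribˡ-sum (x w) (λ v → B w v * y v)) ⟨
      sum (λ w → x w * sum (λ v → B w v * y v)) ∎
      where
      open ≡-Reasoning
      open +-*-Solver
      rearr : ∀ a b c → a * b * c ≡ b * (a * c)
      rearr = solve 3 (λ a b c → a :* b :* c := b :* (a :* c)) refl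

    -- Self-adjointness moves the powers across one at a time. The inner product thus depends on j +
    -- k alone, so it is constant along antidiagonals.
    ⟨iterate,iterate⟩ : ∀ x j k → ⟨ iterate B j x , iterate B k x ⟩ ≡ ⟨ x , iterate B (j ℕ.+ k) x ⟩
    ⟨iterate,iterate⟩ x zero    k = refl
    ⟨iterate,iterate⟩ x (suc j) k = begin
      ⟨ B · iterate B j x , iterate B k x ⟩   ≡⟨ ·-selfAdjoint (iterate B j x) (iterate B k x) ⟩
      ⟨ iterate B j x , iterate B (suc k) x ⟩ ≡⟨ ⟨iterate,iterate⟩ x j (suc k) ⟩
      ⟨ x , iterate B (j ℕ.+ suc k) x ⟩       ≡⟨ cong (λ z → ⟨ x , iterate B z x ⟩) (ℕ.+-suc j k) ⟩
      ⟨ x , iterate B (suc j ℕ.+ k) x ⟩       ∎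
      where open ≡-Reasoning

  ∣iterate∣≤ : ∀ {n} {B : Fin n → Fin n → ℚ} {b} → (∀ v w → ∣ B v w ∣ ≤ ι b) → ∀ {x} → (∀ v → ∣ x v ∣ ≤ 1ℚ) →
    ∀ k v → ∣ iterate B k x v ∣ ≤ ι ((n ℕ.* b) ℕ.^ k)
  ∣iterate∣≤ B≤ {x} x≤ zero v = subst (∣ x v ∣ ≤_) (sym ι-1) (x≤ v)
  ∣iterate∣≤ {n} {B} {b} B≤ {x} x≤ (suc k) v = begin
    ∣ sum (λ w → B v w * iterate B k x w) ∣   ≤⟨ ∣sum∣≤ entry ⟩
    ι n * (ι b * ι (D ℕ.^ k))                 ≡⟨ *-assoc (ι n) (ι b) (ι (D ℕ.^ k)) ⟨
    ι n * ι b * ι (D ℕ.^ k)                   ≡⟨ cong (_* ι (D ℕ.^ k)) (ι-* n b) ⟨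
    ι D * ι (D ℕ.^ k)                         ≡⟨ ι-* D (D ℕ.^ k) ⟨
    ι (D ℕ.* D ℕ.^ k)                         ∎
    where
    open ≤-Reasoning
    D = n ℕ.* b
    entry : ∀ w → ∣ B v w * iterate B k x w ∣ ≤ ι b * ι (D ℕ.^ k)
    entry w = subst (_≤ ι b * ι (D ℕ.^ k)) (sym (∣p*q∣≡∣p∣*∣q∣ (B v w) (iterate B k x w)))
      (*-mono (0≤∣p∣ (B v w)) (B≤ v w) (0≤∣p∣ (iterate B k x w)) (∣iterate∣≤ B≤ x≤ k w))

  partialSum : ∀ {n} → (Fin n → Fin n → ℚ) → (Fin n → ℚ) → ℕ → Fin n → ℚ
  partialSum B x N v = Σ< N λ k → coeff k * iterate B k x v

  -- The constants are fixed before B and x. Later B is a rational approximation of τA that varies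
  -- with N, while the entry bound `b` stays; hence a single `L` serves every N.
  module Energy (n b : ℕ) where

    D K l L : ℕ
    D = n ℕ.* b
    K = proj₁ (1/!-decay D)
    -- Two phases of absolute value at most 2, `n` summands in a moment, and one constant `K` for
    -- each of the two factorials.
    l = 2 ℕ.* 2 ℕ.* n ℕ.* (K ℕ.* K)
    L = (l ℕ.+ l) ℕ.+ (l ℕ.+ l)

    decay : ∀ k → 1/! k * ι (D ℕ.^ k) ≤ ι K * ½^ k * ½^ k
    decay = proj₂ (1/!-decay D)

    module _ {B : Fin n → Fin n → ℚ} (B-sym : ∀ v w → B v w ≡ B w v) (B≤ : ∀ v w → ∣ B v w ∣ ≤ ι b)
      {x : Fin n → ℚ} (x≤ : ∀ v → ∣ x v ∣ ≤ 1ℚ) where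

      μ : ℕ → ℚ
      μ m = ⟨ x , iterate B m x ⟩

      F : ℕ → ℕ → ℚ
      F j k = coeff j * coeff k * μ (j ℕ.+ k)

      expand : ∀ N → ⟨ partialSum B x N , partialSum B x N ⟩ ≡ square N F
      expand N = begin
        sum (λ v → Σ< N (f v) * Σ< N (f v))
          ≡⟨ sum-cong-≗ (λ v → Σ<-square N (f v)) ⟩
        sum (λ v → Σ< N (λ j → Σ< N (λ k → f v j * f v k)))
          ≡⟨ sum-Σ<-comm N (λ v j → Σ< N (λ k → f v j * f v k)) ⟩
        Σ< N (λ j → sum (λ v → Σ< N (λ k → f v j * f v k)))
          ≡⟨ Σ<-cong N (λ j _ → trans (sum-Σ<-comm N (λ v k → f v j * f v k)) (Σ<-cong N (λ k _ → term j k))) ⟩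
        square N F ∎
        where
        open ≡-Reasoning
        open +-*-Solver
        f : Fin n → ℕ → ℚ
        f v k = coeff k * iterate B k x v
        rearr : ∀ a b c d → a * b * (c * d) ≡ a * c * (b * d)
        rearr = solve 4 (λ a b c d → a :* b :* (c :* d) := a :* c :* (b :* d)) refl
        term : ∀ j k → sum (λ v → f v j * f v k) ≡ F j k
        term j k = begin
          sum (λ v → f v j * f v k)
            ≡⟨ sum-cong-≗ (λ v → rearr (coeff j) (iterate B j x v) (coeff k) (iterate B k x v)) ⟩
          sum (λ v → coeff j * coeff k * (iterate B j x v * iterate B k x v))
            ≡⟨ *-distribˡ-sum (coeff j * coeff k) (λ v → iterate B j x v * iterate B k x v) ⟨
          coeff j * coeff k * ⟨ iterate B j x , iterate B k x ⟩
            ≡⟨ cong (coeff j * coeff k *_) (⟨iterate,iterate⟩ B-sym x j k) ⟩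
          F j k ∎

      ∣μ∣≤ : ∀ m → ∣ μ m ∣ ≤ ι n * ι (D ℕ.^ m)
      ∣μ∣≤ m = ∣sum∣≤ λ v → ≤-trans (≤-reflexive (∣p*q∣≡∣p∣*∣q∣ (x v) (iterate B m x v)))
        (≤-trans (*-mono (0≤∣p∣ (x v)) (x≤ v) (0≤∣p∣ (iterate B m x v)) (∣iterate∣≤ B≤ x≤ m v))
          (≤-reflexive (*-identityˡ (ι (D ℕ.^ m)))))

      ∣F∣≤ : ∀ j k → ∣ F j k ∣ ≤ ι l * ½^ j * ½^ j * ½^ k
      ∣F∣≤ j k = begin
        ∣ coeff j * coeff k * μ (j ℕ.+ k) ∣
          ≡⟨ ∣p*q∣≡∣p∣*∣q∣ (coeff j * coeff k) (μ (j ℕ.+ k)) ⟩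
        ∣ coeff j * coeff k ∣ * ∣ μ (j ℕ.+ k) ∣
          ≡⟨ cong (_* ∣ μ (j ℕ.+ k) ∣) (∣p*q∣≡∣p∣*∣q∣ (coeff j) (coeff k)) ⟩
        ∣ coeff j ∣ * ∣ coeff k ∣ * ∣ μ (j ℕ.+ k) ∣
          ≤⟨ *-mono (*-nonneg (0≤∣p∣ (coeff j)) (0≤∣p∣ (coeff k)))
               (*-mono (0≤∣p∣ (coeff j)) (∣coeff∣≤ j) (0≤∣p∣ (coeff k)) (∣coeff∣≤ k))
               (0≤∣p∣ (μ (j ℕ.+ k))) (∣μ∣≤ (j ℕ.+ k)) ⟩
        1/! j * ι 2 * (1/! k * ι 2) * (ι n * ι (D ℕ.^ (j ℕ.+ k)))
          ≡⟨ cong (λ z → 1/! j * ι 2 * (1/! k * ι 2) * (ι n * z))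
               (trans (cong ι (ℕ.^-distribˡ-+-* D j k)) (ι-* (D ℕ.^ j) (D ℕ.^ k))) ⟩
        1/! j * ι 2 * (1/! k * ι 2) * (ι n * (ι (D ℕ.^ j) * ι (D ℕ.^ k)))
          ≡⟨ rearr₁ (1/! j) (ι 2) (1/! k) (ι n) (ι (D ℕ.^ j)) (ι (D ℕ.^ k)) ⟩
        ι 2 * ι 2 * ι n * (1/! j * ι (D ℕ.^ j) * (1/! k * ι (D ℕ.^ k)))
          ≤⟨ *-mono (*-nonneg (*-nonneg (0≤ι 2) (0≤ι 2)) (0≤ι n)) ≤-refl
               (*-nonneg (*-nonneg (0≤1/! j) (0≤ι (D ℕ.^ j))) (*-nonneg (0≤1/! k) (0≤ι (D ℕ.^ k))))
               (*-mono (*-nonneg (0≤1/! j) (0≤ι (D ℕ.^ j))) (decay j)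
                       (*-nonneg (0≤1/! k) (0≤ι (D ℕ.^ k))) decay′) ⟩
        ι 2 * ι 2 * ι n * (ι K * ½^ j * ½^ j * (ι K * ½^ k))
          ≡⟨ rearr₂ (ι 2) (ι n) (ι K) (½^ j) (½^ k) ⟩
        ι 2 * ι 2 * ι n * (ι K * ι K) * ½^ j * ½^ j * ½^ k
          ≡⟨ cong (λ z → z * ½^ j * ½^ j * ½^ k) ιl ⟨
        ι l * ½^ j * ½^ j * ½^ k ∎
        where
        open ≤-Reasoning
        open +-*-Solver
        rearr₁ : ∀ a t b n c d → a * t * (b * t) * (n * (c * d)) ≡ t * t * n * (a * c * (b * d))
        rearr₁ = solve 6 (λ a t b n c d → a :* t :* (b :* t) :* (n :* (c :* d)) := t :* t :* n :* (a :* c :* (b :* d))) refl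
        rearr₂ : ∀ t n c x y → t * t * n * (c * x * x * (c * y)) ≡ t * t * n * (c * c) * x * x * y
        rearr₂ = solve 5 (λ t n c x y → t :* t :* n :* (c :* x :* x :* (c :* y)) := t :* t :* n :* (c :* c) :* x :* x :* y) refl
        -- Only the row index `j` needs the double decay; for `k` one factor is given up.
        decay′ : 1/! k * ι (D ℕ.^ k) ≤ ι K * ½^ k
        decay′ = ≤-trans (decay k) (≤-trans
          (*-mono (*-nonneg (0≤ι K) (0≤½^ k)) ≤-refl (0≤½^ k) (½^≤1 k)) (≤-reflexive (*-identityʳ (ι K * ½^ k))))
        ιl : ι l ≡ ι 2 * ι 2 * ι n * (ι K * ι K)
        ιl = trans (ι-* (2 ℕ.* 2 ℕ.* n) (K ℕ.* K)) (cong₂ _*_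
          (trans (ι-* (2 ℕ.* 2) n) (cong (_* ι n) (ι-* 2 2))) (ι-* K K))

      module _ (parity : ∀ m → σ m ≡ 0ℚ ⊎ μ m ≡ 0ℚ) where

        -- The moment factors out and leaves a coefficient of (cos z + sin z)² = 1 + sin 2z. In even
        -- positive degree that coefficient is zero; in odd degree the moment is.
        antidiagonal : ∀ m → Σ< (suc (suc m)) (λ j → F j (suc m ℕ.∸ j)) ≡ 0ℚ
        antidiagonal m = begin
          Σ< (suc (suc m)) (λ j → F j (suc m ℕ.∸ j))
            ≡⟨ Σ<-cong (suc (suc m)) (λ j j< → trans
                 (cong (λ z → coeff j * coeff (suc m ℕ.∸ j) * μ z) (ℕ.m+[n∸m]≡n (ℕ.s≤s⁻¹ j<)))
                 (*-comm (coeff j * coeff (suc m ℕ.∸ j)) (μ (suc m)))) ⟩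
          Σ< (suc (suc m)) (λ j → μ (suc m) * (coeff j * coeff (suc m ℕ.∸ j)))
            ≡⟨ *-distribˡ-Σ< (suc (suc m)) (μ (suc m)) (λ j → coeff j * coeff (suc m ℕ.∸ j)) ⟨
          μ (suc m) * Σ< (suc (suc m)) (λ j → coeff j * coeff (suc m ℕ.∸ j))
            ≡⟨ vanish (parity (suc m)) ⟩
          0ℚ ∎
          where
          open ≡-Reasoning
          C = Σ< (suc (suc m)) λ j → coeff j * coeff (suc m ℕ.∸ j)
          vanish : σ (suc m) ≡ 0ℚ ⊎ μ (suc m) ≡ 0ℚ → μ (suc m) * C ≡ 0ℚ
          vanish (inj₁ σ≡0) = trans (cong (μ (suc m) *_) (conv-vanishes m σ≡0)) (*-zeroʳ (μ (suc m)))
          vanish (inj₂ μ≡0) = trans (cong (_* C) μ≡0) (*-zeroˡ C)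

        -- Only the corner `F 0 0`, that is the constant term of 1 + sin 2z, survives. The index is
        -- `suc N` because the empty triangle misses that corner.
        triangle≡ : ∀ N → triangle (suc N) F ≡ ⟨ x , x ⟩
        triangle≡ zero    = lemma (μ 0)
          where
          open +-*-Solver
          lemma : ∀ p → 0ℚ + (0ℚ + 1ℚ * (1ℚ + 0ℚ) * (1ℚ * (1ℚ + 0ℚ)) * p) ≡ p
          lemma = solve 1 (λ p → con 0ℚ :+ (con 0ℚ :+ con 1ℚ :* (con 1ℚ :+ con 0ℚ) :* (con 1ℚ :* (con 1ℚ :+ con 0ℚ)) :* p) := p) refl
        triangle≡ (suc N) = trans (triangle-suc (suc N) F) (trans (cong₂ _+_ (triangle≡ N) (antidiagonal N)) (+-identityʳ ⟨ x , x ⟩))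

        energy : ∀ N → ∣ ⟨ partialSum B x (suc N) , partialSum B x (suc N) ⟩ - ⟨ x , x ⟩ ∣ ≤ ι L * ½^ (suc N)
        energy N = begin
          ∣ ⟨ partialSum B x (suc N) , partialSum B x (suc N) ⟩ - ⟨ x , x ⟩ ∣
            ≡⟨ cong₂ (λ y z → ∣ y - z ∣) (expand (suc N)) (sym (triangle≡ N)) ⟩
          ∣ square (suc N) F - triangle (suc N) F ∣
            ≤⟨ square-triangle (suc N) (0≤ι l) ∣F∣≤ ⟩
          (ι l + ι l) * ½^ (suc N) * (1ℚ + 1ℚ)
            ≡⟨ double (ι l + ι l) (½^ (suc N)) ⟩
          ((ι l + ι l) + (ι l + ι l)) * ½^ (suc N)
            ≡⟨ cong (_* ½^ (suc N)) (trans (ι-+ (l ℕ.+ l) (l ℕ.+ l)) (cong₂ _+_ (ι-+ l l) (ι-+ l l))) ⟨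
          ι L * ½^ (suc N) ∎
          where
          open ≤-Reasoning
          open +-*-Solver
          double : ∀ a h → a * h * (1ℚ + 1ℚ) ≡ (a + a) * h
          double = solve 2 (λ a h → a :* h :* (con 1ℚ :+ con 1ℚ) := (a :+ a) :* h) refl

  -- Indicators, squares, and the rational terms of real and complex sums.

  ⟦_⟧ : ∀ {a} {P : Set a} → Dec P → ℕ
  ⟦ P? ⟧ = if does P? then 1 else 0

  length-filter-tabulate : ∀ {a p} {A : Set a} {P : Pred A p} (P? : Decidable P) {n} (f : Fin n → A) →
    length (filter P? (tabulate f)) ≡ ℕSum.sum (λ i → ⟦ P? (f i) ⟧)
  length-filter-tabulate P? {zero}  f = refl
  length-filter-tabulate P? {suc n} f with does (P? (f zero))
  ... | true  = cong suc (length-filter-tabulate P? (f ∘ suc))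
  ... | false = length-filter-tabulate P? (f ∘ suc)

  ι-sum : ∀ {n} (f : Fin n → ℕ) → ι (ℕSum.sum f) ≡ sum (λ v → ι (f v))
  ι-sum {zero}  f = ι-0
  ι-sum {suc n} f = trans (ι-+ (f zero) (ℕSum.sum (f ∘ suc))) (cong (_+_ (ι (f zero))) (ι-sum (f ∘ suc)))

  sum-pick : ∀ {n} (f : Fin n → ℚ) u → (∀ v → v ≢ u → f v ≡ 0ℚ) → sum f ≡ f u
  sum-pick {suc n} f zero    h = trans (cong (_+_ (f zero)) (sum-zero {f = f ∘ suc} (λ v → h (suc v) λ ()))) (+-identityʳ (f zero))
  sum-pick {suc n} f (suc u) h = trans (cong₂ _+_ (h zero λ ()) (sum-pick (f ∘ suc) u λ v v≢u → h (suc v) (v≢u ∘ Fin.suc-injective))) (+-identityˡ (f (suc u)))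

  sum-nonneg : ∀ {n} (f : Fin n → ℚ) → (∀ v → 0ℚ ≤ f v) → 0ℚ ≤ sum f
  sum-nonneg {zero}  f h = ≤-refl
  sum-nonneg {suc n} f h = +-mono-≤ (h zero) (sum-nonneg (f ∘ suc) (h ∘ suc))

  term≤sum : ∀ {n} (f : Fin n → ℚ) → (∀ v → 0ℚ ≤ f v) → ∀ v → f v ≤ sum f
  term≤sum {suc n} f h zero    = p≤p+q (f zero) (sum-nonneg (f ∘ suc) (h ∘ suc))
  term≤sum {suc n} f h (suc v) = ≤-trans (term≤sum (f ∘ suc) (h ∘ suc) v)
    (subst (_≤ sum f) (+-identityˡ (sum (f ∘ suc))) (+-monoˡ-≤ (sum (f ∘ suc)) (h zero)))

  0≤sq : ∀ p → 0ℚ ≤ sq p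
  0≤sq p with ∣p∣≡p∨∣p∣≡-p p
  ... | inj₁ eq = *-nonneg 0≤p 0≤p
    where
    0≤p : 0ℚ ≤ p
    0≤p = subst (0ℚ ≤_) eq (0≤∣p∣ p)
  ... | inj₂ eq = subst (0ℚ ≤_) (lemma p) (*-nonneg 0≤-p 0≤-p)
    where
    open +-*-Solver
    0≤-p : 0ℚ ≤ - p
    0≤-p = subst (0ℚ ≤_) eq (0≤∣p∣ p)
    lemma : ∀ p → (- p) * (- p) ≡ p * p
    lemma = solve 1 (λ p → (:- p) :* (:- p) := p :* p) refl

  sq-∣∣ : ∀ p → sq ∣ p ∣ ≡ sq p
  sq-∣∣ p = trans (sym (∣p*q∣≡∣p∣*∣q∣ p p)) (0≤p⇒∣p∣≡p (0≤sq p))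

  sq≤sq⇒∣∣≤ : ∀ {p q} → 0ℚ ≤ q → sq p ≤ sq q → ∣ p ∣ ≤ q
  sq≤sq⇒∣∣≤ {p} {q} 0≤q h = ≮⇒≥ λ q<∣p∣ → <-irrefl refl (begin-strict
    sq p              ≤⟨ h ⟩
    sq q              ≤⟨ *-mono 0≤q ≤-refl 0≤q (<⇒≤ q<∣p∣) ⟩
    q * ∣ p ∣         <⟨ *-monoˡ-<-pos ∣ p ∣ {{positive (≤-<-trans 0≤q q<∣p∣)}} q<∣p∣ ⟩
    sq ∣ p ∣          ≡⟨ sq-∣∣ p ⟩
    sq p              ∎)
    where open ≤-Reasoning

  seq-∑ᴿ : ∀ {n} (f : Fin n → ℝ) N → seq (∑ᴿ f) N ≡ sum (λ v → seq (f v) N)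
  seq-∑ᴿ {zero}  f N = refl
  seq-∑ᴿ {suc n} f N = cong (_+_ (seq (f zero) N)) (seq-∑ᴿ (f ∘ suc) N)

  seq-re-∑ᶜ : ∀ {n} (f : Fin n → ℂ) N → seq (re (∑ᶜ f)) N ≡ sum (λ v → seq (re (f v)) N)
  seq-re-∑ᶜ {zero}  f N = refl
  seq-re-∑ᶜ {suc n} f N = cong (_+_ (seq (re (f zero)) N)) (seq-re-∑ᶜ (f ∘ suc) N)

  seq-im-∑ᶜ : ∀ {n} (f : Fin n → ℂ) N → seq (im (∑ᶜ f)) N ≡ sum (λ v → seq (im (f v)) N)
  seq-im-∑ᶜ {zero}  f N = refl
  seq-im-∑ᶜ {suc n} f N = cong (_+_ (seq (im (f zero)) N)) (seq-im-∑ᶜ (f ∘ suc) N)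

  seq-∑< : ∀ m (f : ℕ → ℝ) N → seq (∑< m f) N ≡ Σ< m (λ k → seq (f k) N)
  seq-∑< zero    f N = refl
  seq-∑< (suc m) f N = cong (_+ seq (f m) N) (seq-∑< m f N)

  -- The test is oriented as in the entry `1ᴹ v u` of a zeroth matrix power, so that both reduce by
  -- the same case split.
  unit : ∀ {n} → Fin n → Fin n → ℚ
  unit u v = ι ⟦ v Fin.≟ u ⟧

  unit-self : ∀ {n} (u : Fin n) → unit u u ≡ 1ℚ
  unit-self u with u Fin.≟ u
  ... | yes _   = ι-1
  ... | no  u≢u = contradiction refl u≢u

  unit-other : ∀ {n} {u v : Fin n} → v ≢ u → unit u v ≡ 0ℚ
  unit-other {u = u} {v} v≢u with v Fin.≟ u
  ... | yes v≡u = contradiction v≡u v≢u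
  ... | no  _   = ι-0

  -- Parity of walks in a bipartite graph.

  module Sides {n} (side : Fin n → Bool) (B : Fin n → Fin n → ℚ)
    (B-bipartite : ∀ v w → side v ≡ side w → B v w ≡ 0ℚ) where

    SupportedOn : Bool → (Fin n → ℚ) → Set
    SupportedOn s x = ∀ v → side v ≢ s → x v ≡ 0ℚ

    ·-supported : ∀ {s x} → SupportedOn s x → SupportedOn (not s) (B · x)
    ·-supported {s} {x} x-supp v v∉ = sum-zero entry
      where
      v∈ : side v ≡ s
      v∈ = trans (Bool.¬-not v∉) (Bool.not-involutive s)
      entry : ∀ w → B v w * x w ≡ 0ℚ
      entry w with side w Bool.≟ s
      ... | yes w∈ = trans (cong (_* x w) (B-bipartite v w (trans v∈ (sym w∈)))) (*-zeroˡ (x w))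
      ... | no  w∉ = trans (cong (B v w *_) (x-supp w w∉)) (*-zeroʳ (B v w))

    -- Both the phase of iᵏ and the side supporting Bᵏx are determined by the parity of k.
    phase : ∀ {s x} → SupportedOn s x → ∀ k →
      (σ k ≡ 0ℚ × SupportedOn s (iterate B k x)) ⊎ (γ k ≡ 0ℚ × SupportedOn (not s) (iterate B k x))
    phase x-supp zero = inj₁ (refl , x-supp)
    phase {s} x-supp (suc k) with phase x-supp k
    ... | inj₁ (σ≡0 , supp) = inj₂ (cong -_ σ≡0 , ·-supported supp)
    ... | inj₂ (γ≡0 , supp) = inj₁ (γ≡0 , subst (λ s → SupportedOn s _) (Bool.not-involutive s) (·-supported supp))

    σ-vanishes : ∀ {s x} → SupportedOn s x → ∀ k v → side v ≡ s → σ k * iterate B k x v ≡ 0ℚ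
    σ-vanishes {s} {x} x-supp k v v∈ with phase x-supp k
    ... | inj₁ (σ≡0 , _)  = trans (cong (_* iterate B k x v) σ≡0) (*-zeroˡ (iterate B k x v))
    ... | inj₂ (_ , supp) = trans (cong (σ k *_) (supp v (Bool.not-¬ v∈))) (*-zeroʳ (σ k))

    γ-vanishes : ∀ {s x} → SupportedOn s x → ∀ k v → side v ≢ s → γ k * iterate B k x v ≡ 0ℚ
    γ-vanishes {s} {x} x-supp k v v∉ with phase x-supp k
    ... | inj₁ (_ , supp) = trans (cong (γ k *_) (supp v v∉)) (*-zeroʳ (γ k))
    ... | inj₂ (γ≡0 , _)  = trans (cong (_* iterate B k x v) γ≡0) (*-zeroˡ (iterate B k x v))

    -- An odd power of B carries x to the opposite side, where it is orthogonal to x. This removes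
    -- the contribution of sin 2B.
    moment-parity : ∀ {s x} → SupportedOn s x → ∀ k → σ k ≡ 0ℚ ⊎ ⟨ x , iterate B k x ⟩ ≡ 0ℚ
    moment-parity {s} {x} x-supp k with phase x-supp k
    ... | inj₁ (σ≡0 , _)  = inj₁ σ≡0
    ... | inj₂ (_ , supp) = inj₂ (sum-zero entry)
      where
      entry : ∀ v → x v * iterate B k x v ≡ 0ℚ
      entry v with side v Bool.≟ s
      ... | yes v∈ = trans (cong (x v *_) (supp v (Bool.not-¬ v∈))) (*-zeroʳ (x v))
      ... | no  v∉ = trans (cong (_* iterate B k x v) (x-supp v v∉)) (*-zeroˡ (iterate B k x v))

  -- The adjacency matrix and the partial sums of U(t)e_u.

  module _ {n} (X : Graph n) where
    open Graph X

    adj : Fin n → Fin n → ℕ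
    adj v w = ⟦ v ~? w ⟧

    a : Fin n → Fin n → ℚ
    a v w = ι (adj v w)

    adj-sym : ∀ v w → adj v w ≡ adj w v
    adj-sym v w with v ~? w | w ~? v
    ... | yes _   | yes _   = refl
    ... | no  _   | no  _   = refl
    ... | yes v~w | no  w≁v = contradiction (~-sym v~w) w≁v
    ... | no  v≁w | yes w~v = contradiction (~-sym w~v) v≁w

    adj≤1 : ∀ v w → adj v w ℕ.≤ 1
    adj≤1 v w with does (v ~? w)
    ... | true  = ℕ.≤-refl
    ... | false = z≤n

    degree≡ : ∀ v → degree X v ≡ ℕSum.sum (adj v)
    degree≡ v = length-filter-tabulate (v ~?_) (λ w → w)

    module _ (u : Fin n) where

      a·unit : ∀ v → (a · unit u) v ≡ a v u
      a·unit v = trans (sum-pick (λ w → a v w * unit u w) u λ w w≢u → trans (cong (a v w *_) (unit-other w≢u)) (*-zeroʳ (a v w)))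
        (trans (cong (a v u *_) (unit-self u)) (*-identityʳ (a v u)))

      ∣a·unit∣≤1 : ∀ v → ∣ (a · unit u) v ∣ ≤ 1ℚ
      ∣a·unit∣≤1 v = begin
        ∣ (a · unit u) v ∣   ≡⟨ cong ∣_∣ (a·unit v) ⟩
        ∣ a v u ∣            ≡⟨ 0≤p⇒∣p∣≡p (0≤ι (adj v u)) ⟩
        ι (adj v u)          ≤⟨ ι-mono (adj≤1 v u) ⟩
        ι 1                  ≡⟨ ι-1 ⟩
        1ℚ                   ∎
        where open ≤-Reasoning

      ∥a·unit∥² : ⟨ a · unit u , a · unit u ⟩ ≡ ι (degree X u)
      ∥a·unit∥² = trans (sum-cong-≗ λ v → trans (cong₂ _*_ (a·unit v) (a·unit v)) (trans (idem v) (cong ι (adj-sym v u))))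
        (trans (sym (ι-sum (adj u))) (cong ι (sym (degree≡ u))))
        where
        idem : ∀ v → a v u * a v u ≡ a v u
        idem v with does (v ~? u)
        ... | true  = trans (sym (ι-* 1 1)) refl
        ... | false = trans (sym (ι-* 0 0)) refl

    -- The N-th terms of the Cauchy sequences representing U(t)e_u are exactly the
    -- entries of the N-th partial sum of the exponential series at the rational q = seq t N.
    module Approximation (side : Fin n → Bool) (bip : ∀ v w → v ~ w → side v ≢ side w) (u : Fin n) (t : ℝ) (N : ℕ) where

      q : ℚ
      q = seq t N

      B : Fin n → Fin n → ℚ
      B v w = q * a v w

      B-sym : ∀ v w → B v w ≡ B w v
      B-sym v w = cong (λ z → q * ι z) (adj-sym v w)

      a-bipartite : ∀ v w → side v ≡ side w → a v w ≡ 0ℚ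
      a-bipartite v w eq with v ~? w
      ... | yes v~w = contradiction eq (bip v w v~w)
      ... | no  _   = ι-0

      B-bipartite : ∀ v w → side v ≡ side w → B v w ≡ 0ℚ
      B-bipartite v w eq = trans (cong (q *_) (a-bipartite v w eq)) (*-zeroʳ q)

      open Sides side B B-bipartite

      unit-supported : SupportedOn (side u) (unit u)
      unit-supported v v∉ = unit-other λ v≡u → v∉ (cong side v≡u)

      a·unit-supported : SupportedOn (not (side u)) (a · unit u)
      a·unit-supported = Sides.·-supported side a a-bipartite {x = unit u} unit-supported

      B·≡ : ∀ x v → (B · x) v ≡ q * (a · x) v
      B·≡ x v = trans (sum-cong-≗ λ w → *-assoc q (a v w) (x w)) (sym (*-distribˡ-sum q (λ w → a v w * x w)))

      a·iterate : ∀ x k v → (a · iterate B k x) v ≡ iterate B k (a · x) v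
      a·iterate x zero    v = refl
      a·iterate x (suc k) v = begin
        sum (λ w → a v w * (B · iterate B k x) w)
          ≡⟨ sum-cong-≗ (λ w → trans (cong (a v w *_) (trans (B·≡ (iterate B k x) w) (cong (q *_) (a·iterate x k w))))
               (rearr (a v w) q (iterate B k (a · x) w))) ⟩
        sum (λ w → B v w * iterate B k (a · x) w) ∎
        where
        open ≡-Reasoning
        open +-*-Solver
        rearr : ∀ a q y → a * (q * y) ≡ q * a * y
        rearr = solve 3 (λ a q y → a :* (q :* y) := q :* a :* y) refl

      -- A commutes with B = qA, so Ay is the same partial sum started at A e_u. The energy estimate
      -- is applied to that starting vector, whose squared norm is the degree of u.
      a·partialSum : ∀ v → (a · partialSum B (unit u) N) v ≡ partialSum B (a · unit u) N v
      a·partialSum v = begin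
        sum (λ w → a v w * Σ< N (λ k → coeff k * iterate B k (unit u) w))
          ≡⟨ sum-cong-≗ (λ w → *-distribˡ-Σ< N (a v w) (λ k → coeff k * iterate B k (unit u) w)) ⟩
        sum (λ w → Σ< N (λ k → a v w * (coeff k * iterate B k (unit u) w)))
          ≡⟨ sum-Σ<-comm N (λ w k → a v w * (coeff k * iterate B k (unit u) w)) ⟩
        Σ< N (λ k → sum (λ w → a v w * (coeff k * iterate B k (unit u) w)))
          ≡⟨ Σ<-cong N (λ k _ → trans (sum-cong-≗ (λ w → rearr (a v w) (coeff k) (iterate B k (unit u) w)))
               (trans (sym (*-distribˡ-sum (coeff k) (λ w → a v w * iterate B k (unit u) w)))
                 (cong (coeff k *_) (a·iterate (unit u) k v)))) ⟩
        partialSum B (a · unit u) N v ∎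
        where
        open ≡-Reasoning
        open +-*-Solver
        rearr : ∀ a c y → a * (c * y) ≡ c * (a * y)
        rearr = solve 3 (λ a c y → a :* (c :* y) := c :* (a :* y)) refl

      itA : Matrix n
      itA v w = (ⅈ *ᶜ (t +i 0ᴿ)) *ᶜ adjacency X v w

      re-adjacency : ∀ v w → seq (re (adjacency X v w)) N ≡ a v w
      re-adjacency v w with does (v ~? w)
      ... | true  = sym ι-1
      ... | false = sym ι-0

      im-adjacency : ∀ v w → seq (im (adjacency X v w)) N ≡ 0ℚ
      im-adjacency v w with does (v ~? w)
      ... | true  = refl
      ... | false = refl

      re-itA : ∀ v w → seq (re (itA v w)) N ≡ 0ℚ
      re-itA v w = trans (cong₂ (λ r i → (0ℚ * q - 1ℚ * 0ℚ) * r - (0ℚ * 0ℚ + 1ℚ * q) * i) (re-adjacency v w) (im-adjacency v w))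
        (lemma q (a v w))
        where
        open +-*-Solver
        lemma : ∀ q r → (0ℚ * q - 1ℚ * 0ℚ) * r - (0ℚ * 0ℚ + 1ℚ * q) * 0ℚ ≡ 0ℚ
        lemma = solve 2 (λ q r → (con 0ℚ :* q :- con 1ℚ :* con 0ℚ) :* r :- (con 0ℚ :* con 0ℚ :+ con 1ℚ :* q) :* con 0ℚ := con 0ℚ) refl

      im-itA : ∀ v w → seq (im (itA v w)) N ≡ B v w
      im-itA v w = trans (cong₂ (λ r i → (0ℚ * q - 1ℚ * 0ℚ) * i + (0ℚ * 0ℚ + 1ℚ * q) * r) (re-adjacency v w) (im-adjacency v w))
        (lemma q (a v w))
        where
        open +-*-Solver
        lemma : ∀ q r → (0ℚ * q - 1ℚ * 0ℚ) * 0ℚ + (0ℚ * 0ℚ + 1ℚ * q) * r ≡ q * r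
        lemma = solve 2 (λ q r → (con 0ℚ :* q :- con 1ℚ :* con 0ℚ) :* con 0ℚ :+ (con 0ℚ :* con 0ℚ :+ con 1ℚ :* q) :* r := q :* r) refl

      -- Column u of (iB)^k = i^k B^k. Multiplication by iB exchanges the real and imaginary parts
      -- up to a sign, so the two inductions are mutual.
      re-power : ∀ k v → seq (re ((itA ^ᴹ k) v u)) N ≡ γ k * iterate B k (unit u) v
      im-power : ∀ k v → seq (im ((itA ^ᴹ k) v u)) N ≡ σ k * iterate B k (unit u) v
      re-power zero v with does (v Fin.≟ u)
      ... | true  = sym (trans (*-identityˡ (ι 1)) ι-1)
      ... | false = sym (trans (*-identityˡ (ι 0)) ι-0)
      re-power (suc k) v = begin
        seq (re (∑ᶜ λ w → itA v w *ᶜ (itA ^ᴹ k) w u)) N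
          ≡⟨ seq-re-∑ᶜ (λ w → itA v w *ᶜ (itA ^ᴹ k) w u) N ⟩
        sum (λ w → seq (re (itA v w)) N * seq (re ((itA ^ᴹ k) w u)) N - seq (im (itA v w)) N * seq (im ((itA ^ᴹ k) w u)) N)
          ≡⟨ sum-cong-≗ (λ w → trans (cong₂ _-_ (cong (_* seq (re ((itA ^ᴹ k) w u)) N) (re-itA v w))
               (cong₂ _*_ (im-itA v w) (im-power k w)))
               (lemma (seq (re ((itA ^ᴹ k) w u)) N) (B v w) (σ k) (iterate B k (unit u) w))) ⟩
        sum (λ w → (- σ k) * (B v w * iterate B k (unit u) w))
          ≡⟨ *-distribˡ-sum (- σ k) (λ w → B v w * iterate B k (unit u) w) ⟨
        (- σ k) * iterate B (suc k) (unit u) v ∎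
        where
        open ≡-Reasoning
        open +-*-Solver
        lemma : ∀ r b s y → 0ℚ * r - b * (s * y) ≡ (- s) * (b * y)
        lemma = solve 4 (λ r b s y → con 0ℚ :* r :- b :* (s :* y) := (:- s) :* (b :* y)) refl
      im-power zero v with does (v Fin.≟ u)
      ... | true  = sym (*-zeroˡ (ι 1))
      ... | false = sym (*-zeroˡ (ι 0))
      im-power (suc k) v = begin
        seq (im (∑ᶜ λ w → itA v w *ᶜ (itA ^ᴹ k) w u)) N
          ≡⟨ seq-im-∑ᶜ (λ w → itA v w *ᶜ (itA ^ᴹ k) w u) N ⟩
        sum (λ w → seq (re (itA v w)) N * seq (im ((itA ^ᴹ k) w u)) N + seq (im (itA v w)) N * seq (re ((itA ^ᴹ k) w u)) N)
          ≡⟨ sum-cong-≗ (λ w → trans (cong₂ _+_ (cong (_* seq (im ((itA ^ᴹ k) w u)) N) (re-itA v w))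
               (cong₂ _*_ (im-itA v w) (re-power k w)))
               (lemma (seq (im ((itA ^ᴹ k) w u)) N) (B v w) (γ k) (iterate B k (unit u) w))) ⟩
        sum (λ w → γ k * (B v w * iterate B k (unit u) w))
          ≡⟨ *-distribˡ-sum (γ k) (λ w → B v w * iterate B k (unit u) w) ⟨
        γ k * iterate B (suc k) (unit u) v ∎
        where
        open ≡-Reasoning
        open +-*-Solver
        lemma : ∀ r b s y → 0ℚ * r + b * (s * y) ≡ s * (b * y)
        lemma = solve 4 (λ r b s y → con 0ℚ :* r :+ b :* (s :* y) := s :* (b :* y)) refl

      reU imU y : Fin n → ℚ
      reU v = seq (re (U X t v u)) N
      imU v = seq (im (U X t v u)) N
      y = partialSum B (unit u) N

      reU≡ : ∀ v → reU v ≡ Σ< N (λ k → 1/! k * (γ k * iterate B k (unit u) v))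
      reU≡ v = trans (seq-∑< N (λ k → re (expTerm itA v u k)) N) (Σ<-cong N (λ k _ → cong (1/! k *_) (re-power k v)))

      imU≡ : ∀ v → imU v ≡ Σ< N (λ k → 1/! k * (σ k * iterate B k (unit u) v))
      imU≡ v = trans (seq-∑< N (λ k → im (expTerm itA v u k)) N) (Σ<-cong N (λ k _ → cong (1/! k *_) (im-power k v)))

      y≡ : ∀ v → y v ≡ reU v + imU v
      y≡ v = begin
        Σ< N (λ k → 1/! k * ϕ k * iterate B k (unit u) v)
          ≡⟨ Σ<-cong N (λ k _ → lemma (1/! k) (γ k) (σ k) (iterate B k (unit u) v)) ⟩
        Σ< N (λ k → 1/! k * (γ k * iterate B k (unit u) v) + 1/! k * (σ k * iterate B k (unit u) v))
          ≡⟨ Σ<-distrib-+ N _ _ ⟩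
        Σ< N (λ k → 1/! k * (γ k * iterate B k (unit u) v)) + Σ< N (λ k → 1/! k * (σ k * iterate B k (unit u) v))
          ≡⟨ cong₂ _+_ (reU≡ v) (imU≡ v) ⟨
        reU v + imU v ∎
        where
        open ≡-Reasoning
        open +-*-Solver
        lemma : ∀ f c s p → f * (c + s) * p ≡ f * (c * p) + f * (s * p)
        lemma = solve 4 (λ f c s p → f :* (c :+ s) :* p := f :* (c :* p) :+ f :* (s :* p)) refl

      reU*imU : ∀ v → reU v * imU v ≡ 0ℚ
      reU*imU v with side v Bool.≟ side u
      ... | yes v∈ = trans (cong (reU v *_) (trans (imU≡ v) (Σ<-zero N λ k _ →
              trans (cong (1/! k *_) (σ-vanishes {x = unit u} unit-supported k v v∈)) (*-zeroʳ (1/! k))))) (*-zeroʳ (reU v))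
      ... | no  v∉ = trans (cong (_* imU v) (trans (reU≡ v) (Σ<-zero N λ k _ →
              trans (cong (1/! k *_) (γ-vanishes {x = unit u} unit-supported k v v∉)) (*-zeroʳ (1/! k))))) (*-zeroˡ (imU v))

      sq-y : ∀ v → sq (y v) ≡ sq (reU v) + sq (imU v)
      sq-y v = trans (cong sq (y≡ v)) (trans (lemma (reU v) (imU v))
        (trans (cong (λ z → sq (reU v) + sq (imU v) + (z + z)) (reU*imU v)) (+-identityʳ _)))
        where
        open +-*-Solver
        lemma : ∀ a b → (a + b) * (a + b) ≡ a * a + b * b + (a * b + a * b)
        lemma = solve 2 (λ a b → (a :+ b) :* (a :+ b) := a :* a :+ b :* b :+ (a :* b :+ a :* b)) refl

  -- From the mixing hypothesis to an almost flat rational vector.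

  re-column : ∀ {n} (M : Matrix n) u v N → seq (re ((M *ⱽ 𝐞 u) v)) N ≡ seq (re (M v u)) N
  re-column {n} M u v N = trans (seq-re-∑ᶜ (λ w → M v w *ᶜ 𝐞 u w) N) (trans (sum-pick f u off) on)
    where
    open +-*-Solver
    f : Fin n → ℚ
    f w = seq (re (M v w *ᶜ 𝐞 u w)) N
    zeros : ∀ p q → p * 0ℚ - q * 0ℚ ≡ 0ℚ
    zeros = solve 2 (λ p q → p :* con 0ℚ :- q :* con 0ℚ := con 0ℚ) refl
    one : ∀ p q → p * 1ℚ - q * 0ℚ ≡ p
    one = solve 2 (λ p q → p :* con 1ℚ :- q :* con 0ℚ := p) refl
    off : ∀ w → w ≢ u → f w ≡ 0ℚ
    off w w≢u with u Fin.≟ w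
    ... | yes u≡w = contradiction (sym u≡w) w≢u
    ... | no  _   = zeros (seq (re (M v w)) N) (seq (im (M v w)) N)
    on : f u ≡ seq (re (M v u)) N
    on with u Fin.≟ u
    ... | yes _   = one (seq (re (M v u)) N) (seq (im (M v u)) N)
    ... | no  u≢u = contradiction refl u≢u

  im-column : ∀ {n} (M : Matrix n) u v N → seq (im ((M *ⱽ 𝐞 u) v)) N ≡ seq (im (M v u)) N
  im-column {n} M u v N = trans (seq-im-∑ᶜ (λ w → M v w *ᶜ 𝐞 u w) N) (trans (sum-pick f u off) on)
    where
    open +-*-Solver
    f : Fin n → ℚ
    f w = seq (im (M v w *ᶜ 𝐞 u w)) N
    zeros : ∀ p q → p * 0ℚ + q * 0ℚ ≡ 0ℚ
    zeros = solve 2 (λ p q → p :* con 0ℚ :+ q :* con 0ℚ := con 0ℚ) refl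
    one : ∀ p q → p * 0ℚ + q * 1ℚ ≡ q
    one = solve 2 (λ p q → p :* con 0ℚ :+ q :* con 1ℚ := q) refl
    off : ∀ w → w ≢ u → f w ≡ 0ℚ
    off w w≢u with u Fin.≟ w
    ... | yes u≡w = contradiction (sym u≡w) w≢u
    ... | no  _   = zeros (seq (re (M v w)) N) (seq (im (M v w)) N)
    on : f u ≡ seq (im (M v u)) N
    on with u Fin.≟ u
    ... | yes _   = one (seq (re (M v u)) N) (seq (im (M v u)) N)
    ... | no  u≢u = contradiction refl u≢u

  1/size : ∀ {n} → Fin n → ℚ
  1/size {n} u = (+ 1 / n) {{Fin.nonZeroIndex u}}

  ι-size : ∀ {n} (u : Fin n) → ι n * 1/size u ≡ 1ℚ
  ι-size {suc n} u = trans (*-comm (ι (suc n)) (+ 1 / suc n)) (trans (cong (_* ι (suc n)) (+1/ n)) (δ-inv n))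

  module _ {n} (M : Matrix n) (u : Fin n) (c : ℚ) where

    deviation : Vector n
    deviation = (M *ⱽ 𝐞 u) ∘ⱽ (conjᴹ M *ⱽ 𝐞 u) -ⱽ fromℚ c •ⱽ 𝟏

    re-deviation : ∀ v N → seq (re (deviation v)) N ≡ sq (seq (re (M v u)) N) + sq (seq (im (M v u)) N) - c
    re-deviation v N = trans (cong (_- c * 1ℚ) (cong₂ _-_
        (cong₂ _*_ (re-column M u v N) (re-column (conjᴹ M) u v N))
        (cong₂ _*_ (im-column M u v N) (im-column (conjᴹ M) u v N))))
      (lemma (seq (re (M v u)) N) (seq (im (M v u)) N) c)
      where
      open +-*-Solver
      lemma : ∀ r i c → r * r - i * (- i) - c * 1ℚ ≡ r * r + i * i - c
      lemma = solve 3 (λ r i c → r :* r :- i :* (:- i) :- c :* con 1ℚ := r :* r :+ i :* i :- c) refl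

    -- The N-th term of the norm is a rational root `root Q N`, which may fall short of the true
    -- root of `Q` by up to `δ N`. Half of η covers the norm and the other half this defect; one
    -- coordinate is then bounded by the whole sum of squares.
    deviation-bound : ∀ {η} N → 0ℚ ≤ η → seq ‖ deviation ‖ N ≤ ½ * η → δ N ≤ ½ * η →
      ∀ v → ∣ sq (seq (re (M v u)) N) + sq (seq (im (M v u)) N) - c ∣ ≤ η
    deviation-bound {η} N 0≤η norm≤ δ≤ v = subst (λ p → ∣ p ∣ ≤ η) (re-deviation v N) (sq≤sq⇒∣∣≤ 0≤η (begin
      sq (x v)                            ≤⟨ p≤p+q (sq (x v)) (0≤sq (y v)) ⟩
      sq (x v) + sq (y v)                 ≤⟨ term≤sum (λ w → sq (x w) + sq (y w)) (λ w → +-mono-≤ (0≤sq (x w)) (0≤sq (y w))) v ⟩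
      sum (λ w → sq (x w) + sq (y w))     ≡⟨ seq-∑ᴿ (λ w → ∣ deviation w ∣²) N ⟨
      Q                                   ≤⟨ <⇒≤ (root-upper Q N) ⟩
      sq (root Q N + δ N)                 ≤⟨ sq-mono (+-mono-≤ (0≤root Q N) (0≤δ N)) (+-mono-≤ norm≤ δ≤) ⟩
      sq (½ * η + ½ * η)                  ≡⟨ cong sq (½+½ η) ⟩
      sq η                                ∎))
      where
      open ≤-Reasoning
      x y : Fin n → ℚ
      x w = seq (re (deviation w)) N
      y w = seq (im (deviation w)) N
      Q : ℚ
      Q = seq (∑ᴿ λ w → ∣ deviation w ∣²) N

    norm-bound : ∀ η → 0ℚ < η → ‖ deviation ‖ <ᴿ fromℚ (½ * η) →
      ∃[ N₀ ] (∀ N → N₀ ℕ.≤ N → ∀ v → ∣ sq (seq (re (M v u)) N) + sq (seq (im (M v u)) N) - c ∣ ≤ η)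
    norm-bound η 0<η (ε , 0<ε , N₁ , h) =
      let N₂ , δ≤ = archimedean (½ * η) (½-pos 0<η)
      in N₁ ℕ.⊔ N₂ , λ N N≥ → deviation-bound N (<⇒≤ 0<η)
        (≤-trans (p≤p+q (seq ‖ deviation ‖ N) (<⇒≤ 0<ε)) (h N (ℕ.m⊔n≤o⇒m≤o N₁ N₂ N≥)))
        (δ≤ N (ℕ.m⊔n≤o⇒n≤o N₁ N₂ N≥))

  mixing-entries : ∀ {n} (X : Graph n) u → LocalεUniformMixing X u → ∀ η → 0ℚ < η →
    ∃[ τ ] ∃[ N₀ ] (∀ N → N₀ ℕ.≤ N → ∀ v →
      ∣ sq (seq (re (U X τ v u)) N) + sq (seq (im (U X τ v u)) N) - 1/size u ∣ ≤ η)
  mixing-entries X u mix η 0<η =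
    let τ , close = mix (fromℚ (½ * η)) (½ * η , ½-pos 0<η , 0 , λ _ _ → ≤-reflexive (+-identityˡ (½ * η)))
    in τ , norm-bound (U X τ) u (1/size u) η 0<η close

  ι-δ-cancel : ∀ L {p} → 0ℚ ≤ p → ι L * (δ L * p) ≤ p
  ι-δ-cancel L {p} 0≤p = begin
    ι L * (δ L * p)          ≤⟨ *-mono (0≤ι L) (ι-mono (ℕ.n≤1+n L)) (*-nonneg (0≤δ L) 0≤p) ≤-refl ⟩
    ι (suc L) * (δ L * p)    ≡⟨ rearr (ι (suc L)) (δ L) p ⟩
    δ L * ι (suc L) * p      ≡⟨ cong (_* p) (δ-inv L) ⟩
    1ℚ * p                   ≡⟨ *-identityˡ p ⟩
    p                        ∎
    where
    open ≤-Reasoning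
    open +-*-Solver
    rearr : ∀ a b c → a * (b * c) ≡ b * a * c
    rearr = solve 3 (λ a b c → a :* (b :* c) := b :* a :* c) refl

  conservation : ∀ {n} (X : Graph n) ((side , bip) : Bipartite X) u τ →
    ∃[ L ] (∀ N → let y = Approximation.y X side bip u τ (suc N) in
      ∣ ⟨ a X · y , a X · y ⟩ - ι (degree X u) ∣ ≤ ι L * ½^ (suc N))
  conservation {n} X (side , bip) u τ = Energy.L n b , conserved
    where
    b : ℕ
    b = proj₁ (bounded τ)
    x : Fin n → ℚ
    x = a X · unit u
    conserved : ∀ N → let y = Approximation.y X side bip u τ (suc N) in
      ∣ ⟨ a X · y , a X · y ⟩ - ι (degree X u) ∣ ≤ ι (Energy.L n b) * ½^ (suc N)
    conserved N = begin
      ∣ ⟨ a X · y , a X · y ⟩ - ι (degree X u) ∣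
        ≡⟨ cong₂ (λ p q → ∣ p - q ∣) (sum-cong-≗ λ v → cong₂ _*_ (a·partialSum v) (a·partialSum v)) (sym (∥a·unit∥² X u)) ⟩
      ∣ ⟨ partialSum B x (suc N) , partialSum B x (suc N) ⟩ - ⟨ x , x ⟩ ∣
        ≤⟨ Energy.energy n b B-sym B≤ (∣a·unit∣≤1 X u) (Sides.moment-parity side B B-bipartite {x = x} a·unit-supported) N ⟩
      ι (Energy.L n b) * ½^ (suc N) ∎
      where
      open ≤-Reasoning
      open Approximation X side bip u τ (suc N)
      B≤ : ∀ v w → ∣ B v w ∣ ≤ ι b
      B≤ v w = begin
        ∣ q * a X v w ∣        ≡⟨ ∣p*q∣≡∣p∣*∣q∣ q (a X v w) ⟩
        ∣ q ∣ * ∣ a X v w ∣    ≡⟨ cong (∣ q ∣ *_) (0≤p⇒∣p∣≡p (0≤ι (adj X v w))) ⟩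
        ∣ q ∣ * a X v w        ≤⟨ *-mono (0≤∣p∣ q) (proj₂ (bounded τ) (suc N)) (0≤ι (adj X v w)) (ι-mono (adj≤1 X v w)) ⟩
        ι b * ι 1              ≡⟨ cong (ι b *_) ι-1 ⟩
        ι b * 1ℚ               ≡⟨ *-identityʳ (ι b) ⟩
        ι b                    ∎

  approximate-state : ∀ {n} (X : Graph n) → Bipartite X → ∀ u → LocalεUniformMixing X u → ∀ η → 0ℚ < η →
    ∃[ y ] (∀ v → ∣ sq (y v) - 1/size u ∣ ≤ η) × ∣ ⟨ a X · y , a X · y ⟩ - ι (degree X u) ∣ ≤ η
  approximate-state {n} X (side , bip) u mix η 0<η =
    let τ , N₁ , entries = mixing-entries X u mix η 0<η
        L , conserved = conservation X (side , bip) u τ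
        -- The order of choices matters: η determines τ, τ determines L, and only then is N taken
        -- large enough to bring L ½^(N+1) below η.
        N₂ , δ≤ = archimedean (δ L * η) (*-pos (0<δ L) 0<η)
        N = N₁ ℕ.⊔ N₂
        open Approximation X side bip u τ (suc N)
    in y
     , (λ v → subst (λ p → ∣ p - 1/size u ∣ ≤ η) (sym (sq-y v)) (entries (suc N) (ℕ.m≤n⇒m≤1+n (ℕ.m≤m⊔n N₁ N₂)) v))
     , ≤-trans (conserved N) (≤-trans
         (*-mono (0≤ι L) ≤-refl (0≤½^ (suc N)) (≤-trans (½^≤δ (suc N)) (δ≤ (suc N) (ℕ.m≤n⇒m≤1+n (ℕ.m≤n⊔m N₁ N₂)))))
         (ι-δ-cancel L (<⇒≤ 0<η)))

  -- Replacing entries by signs.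

  -- Zero counts as positive: `sgn` must take only the values 1 and -1, since every neighbour has to
  -- contribute an odd number for s_v ≡ d_v (mod 2).
  isPos isNeg : ℚ → ℕ
  isPos p = ⟦ 0ℚ ≤? p ⟧
  isNeg p = 1 ℕ.∸ isPos p

  sgn : ℚ → ℚ
  sgn p = ι (isPos p) - ι (isNeg p)

  sgn-cases : ∀ p → (sgn p ≡ 1ℚ × ∣ p ∣ ≡ p) ⊎ (sgn p ≡ - 1ℚ × ∣ p ∣ ≡ - p)
  sgn-cases p = go (0ℚ ≤? p)
    where
    go : (0≤? : Dec (0ℚ ≤ p)) → let s = ι ⟦ 0≤? ⟧ - ι (1 ℕ.∸ ⟦ 0≤? ⟧) in (s ≡ 1ℚ × ∣ p ∣ ≡ p) ⊎ (s ≡ - 1ℚ × ∣ p ∣ ≡ - p)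
    go (yes 0≤p) = inj₁ (cong₂ _-_ ι-1 ι-0 , 0≤p⇒∣p∣≡p 0≤p)
    go (no  0≰p) = inj₂ (cong₂ _-_ ι-0 ι-1 , trans (sym (∣-p∣≡∣p∣ p)) (0≤p⇒∣p∣≡p (neg-antimono-≤ (<⇒≤ (≰⇒> 0≰p)))))

  sgn*∣∣ : ∀ p → sgn p * ∣ p ∣ ≡ p
  sgn*∣∣ p with sgn-cases p
  ... | inj₁ (s≡ , eq) = trans (cong₂ _*_ s≡ eq) (*-identityˡ p)
  ... | inj₂ (s≡ , eq) = trans (cong₂ _*_ s≡ eq) (lemma p)
    where
    open +-*-Solver
    lemma : ∀ p → (- 1ℚ) * (- p) ≡ p
    lemma = solve 1 (λ p → (:- con 1ℚ) :* (:- p) := p) refl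

  ∣sgn∣ : ∀ p → ∣ sgn p ∣ ≡ 1ℚ
  ∣sgn∣ p with sgn-cases p
  ... | inj₁ (s≡ , _) = cong ∣_∣ s≡
  ... | inj₂ (s≡ , _) = cong ∣_∣ s≡

  -- t² - 1 has the second factor 1 + t ≥ 1. This passes from squares back to the numbers themselves
  -- without extracting a root.
  ∣t-1∣≤∣t²-1∣ : ∀ {t} → 0ℚ ≤ t → ∣ t - 1ℚ ∣ ≤ ∣ sq t - 1ℚ ∣
  ∣t-1∣≤∣t²-1∣ {t} 0≤t = begin
    ∣ t - 1ℚ ∣                   ≡⟨ *-identityʳ ∣ t - 1ℚ ∣ ⟨
    ∣ t - 1ℚ ∣ * 1ℚ              ≤⟨ *-mono (0≤∣p∣ (t - 1ℚ)) ≤-refl 0≤1 (p≤p+q 1ℚ 0≤t) ⟩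
    ∣ t - 1ℚ ∣ * (1ℚ + t)        ≡⟨ cong (∣ t - 1ℚ ∣ *_) (0≤p⇒∣p∣≡p (+-mono-≤ 0≤1 0≤t)) ⟨
    ∣ t - 1ℚ ∣ * ∣ 1ℚ + t ∣      ≡⟨ ∣p*q∣≡∣p∣*∣q∣ (t - 1ℚ) (1ℚ + t) ⟨
    ∣ (t - 1ℚ) * (1ℚ + t) ∣      ≡⟨ cong ∣_∣ (lemma t) ⟩
    ∣ sq t - 1ℚ ∣                ∎
    where
    open ≤-Reasoning
    open +-*-Solver
    lemma : ∀ t → (t - 1ℚ) * (1ℚ + t) ≡ t * t - 1ℚ
    lemma = solve 1 (λ t → (t :- con 1ℚ) :* (con 1ℚ :+ t) := t :* t :- con 1ℚ) refl

  -- Since θ ≤ 1, p is at most 2 in absolute value, which gives 2θ + θ.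
  ∣pq-1∣≤ : ∀ {p q θ} → 0ℚ ≤ θ → θ ≤ 1ℚ → ∣ p - 1ℚ ∣ ≤ θ → ∣ q - 1ℚ ∣ ≤ θ → ∣ p * q - 1ℚ ∣ ≤ ι 3 * θ
  ∣pq-1∣≤ {p} {q} {θ} 0≤θ θ≤1 p≈1 q≈1 = begin
    ∣ p * q - 1ℚ ∣
      ≡⟨ cong ∣_∣ (split p q) ⟩
    ∣ ((p - 1ℚ) + 1ℚ) * (q - 1ℚ) + (p - 1ℚ) ∣
      ≤⟨ ∣p+q∣≤∣p∣+∣q∣ (((p - 1ℚ) + 1ℚ) * (q - 1ℚ)) (p - 1ℚ) ⟩
    ∣ ((p - 1ℚ) + 1ℚ) * (q - 1ℚ) ∣ + ∣ p - 1ℚ ∣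
      ≡⟨ cong (_+ ∣ p - 1ℚ ∣) (∣p*q∣≡∣p∣*∣q∣ ((p - 1ℚ) + 1ℚ) (q - 1ℚ)) ⟩
    ∣ (p - 1ℚ) + 1ℚ ∣ * ∣ q - 1ℚ ∣ + ∣ p - 1ℚ ∣
      ≤⟨ +-mono-≤ (*-mono (0≤∣p∣ ((p - 1ℚ) + 1ℚ))
           (≤-trans (∣p+q∣≤∣p∣+∣q∣ (p - 1ℚ) 1ℚ) (+-monoˡ-≤ 1ℚ (≤-trans p≈1 θ≤1))) (0≤∣p∣ (q - 1ℚ)) q≈1) p≈1 ⟩
    (1ℚ + 1ℚ) * θ + θ
      ≡⟨ cong (λ z → z * θ + θ) ι-2 ⟨
    ι 2 * θ + θ
      ≡⟨ cong (_+_ (ι 2 * θ)) (trans (cong (_* θ) ι-1) (*-identityˡ θ)) ⟨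
    ι 2 * θ + ι 1 * θ
      ≡⟨ *-distribʳ-+ θ (ι 2) (ι 1) ⟨
    (ι 2 + ι 1) * θ
      ≡⟨ cong (_* θ) (ι-+ 2 1) ⟨
    ι 3 * θ ∎
    where
    open ≤-Reasoning
    open +-*-Solver
    split : ∀ p q → p * q - 1ℚ ≡ ((p - 1ℚ) + 1ℚ) * (q - 1ℚ) + (p - 1ℚ)
    split = solve 2 (λ p q → p :* q :- con 1ℚ := ((p :- con 1ℚ) :+ con 1ℚ) :* (q :- con 1ℚ) :+ (p :- con 1ℚ)) refl

  -- Up to the sign `sgn x * sgn y` the difference is t - 1 with t = c|x||y|. Its square is (c x²)(c
  -- y²), a product of two numbers known to be near 1.
  sgn-close : ∀ {c x y θ} → 0ℚ ≤ c → 0ℚ ≤ θ → θ ≤ 1ℚ → ∣ c * sq x - 1ℚ ∣ ≤ θ → ∣ c * sq y - 1ℚ ∣ ≤ θ →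
    ∣ c * (x * y) - sgn x * sgn y ∣ ≤ ι 3 * θ
  sgn-close {c} {x} {y} {θ} 0≤c 0≤θ θ≤1 hx hy = begin
    ∣ c * (x * y) - sgn x * sgn y ∣
      ≡⟨ cong₂ (λ p q → ∣ c * (p * q) - sgn x * sgn y ∣) (sgn*∣∣ x) (sgn*∣∣ y) ⟨
    ∣ c * (sgn x * ∣ x ∣ * (sgn y * ∣ y ∣)) - sgn x * sgn y ∣
      ≡⟨ cong ∣_∣ (factor c (sgn x) (sgn y) ∣ x ∣ ∣ y ∣) ⟩
    ∣ sgn x * (sgn y * (t - 1ℚ)) ∣
      ≡⟨ trans (∣p*q∣≡∣p∣*∣q∣ (sgn x) (sgn y * (t - 1ℚ))) (cong₂ _*_ (∣sgn∣ x)
           (trans (∣p*q∣≡∣p∣*∣q∣ (sgn y) (t - 1ℚ)) (cong (_* ∣ t - 1ℚ ∣) (∣sgn∣ y)))) ⟩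
    1ℚ * (1ℚ * ∣ t - 1ℚ ∣)
      ≡⟨ trans (*-identityˡ _) (*-identityˡ _) ⟩
    ∣ t - 1ℚ ∣
      ≤⟨ ∣t-1∣≤∣t²-1∣ (*-nonneg 0≤c (*-nonneg (0≤∣p∣ x) (0≤∣p∣ y))) ⟩
    ∣ sq t - 1ℚ ∣
      ≡⟨ cong (λ z → ∣ z - 1ℚ ∣) (trans (square-t c ∣ x ∣ ∣ y ∣) (cong₂ (λ p q → c * p * (c * q)) (sq-∣∣ x) (sq-∣∣ y))) ⟩
    ∣ c * sq x * (c * sq y) - 1ℚ ∣
      ≤⟨ ∣pq-1∣≤ {c * sq x} {c * sq y} 0≤θ θ≤1 hx hy ⟩
    ι 3 * θ ∎
    where
    open ≤-Reasoning
    open +-*-Solver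
    t = c * (∣ x ∣ * ∣ y ∣)
    factor : ∀ c s s′ p q → c * (s * p * (s′ * q)) - s * s′ ≡ s * (s′ * (c * (p * q) - 1ℚ))
    factor = solve 5 (λ c s s′ p q → c :* (s :* p :* (s′ :* q)) :- s :* s′ := s :* (s′ :* (c :* (p :* q) :- con 1ℚ))) refl
    square-t : ∀ c p q → c * (p * q) * (c * (p * q)) ≡ c * (p * p) * (c * (q * q))
    square-t = solve 3 (λ c p q → c :* (p :* q) :* (c :* (p :* q)) := c :* (p :* p) :* (c :* (q :* q))) refl

  *sum-sum : ∀ {n} c (f g : Fin n → ℚ) → c * sum f - sum g ≡ sum (λ v → c * f v - g v)
  *sum-sum {zero}  c f g = lemma c
    where
    open +-*-Solver
    lemma : ∀ c → c * 0ℚ - 0ℚ ≡ 0ℚ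
    lemma = solve 1 (λ c → c :* con 0ℚ :- con 0ℚ := con 0ℚ) refl
  *sum-sum {suc n} c f g = trans (lemma c (f zero) (sum (f ∘ suc)) (g zero) (sum (g ∘ suc)))
    (cong (_+_ (c * f zero - g zero)) (*sum-sum c (f ∘ suc) (g ∘ suc)))
    where
    open +-*-Solver
    lemma : ∀ c p q r s → c * (p + q) - (r + s) ≡ (c * p - r) + (c * q - s)
    lemma = solve 5 (λ c p q r s → c :* (p :+ q) :- (r :+ s) := (c :* p :- r) :+ (c :* q :- s)) refl

  sum-square : ∀ {n} (f : Fin n → ℚ) → sum f * sum f ≡ sum (λ v → sum (λ w → f v * f w))
  sum-square f = trans (*-distribʳ-sum (sum f) f) (sum-cong-≗ λ v → *-distribˡ-sum (f v) f)

  ι-gap : ∀ {m n} → m ℕ.< n → 1ℚ ≤ ∣ ι n - ι m ∣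
  ι-gap {m} {n} m<n = ≤-trans (subst (_≤ ι n - ι m) (lemma (ι m)) (+-monoˡ-≤ (- ι m)
    (subst (_≤ ι n) (trans (ι-+ 1 m) (cong (_+ ι m) ι-1)) (ι-mono m<n)))) (p≤∣p∣ (ι n - ι m))
    where
    open +-*-Solver
    lemma : ∀ p → 1ℚ + p - p ≡ 1ℚ
    lemma = solve 1 (λ p → con 1ℚ :+ p :- p := con 1ℚ) refl

  ι-injective-≈ : ∀ {m n} → ∣ ι m - ι n ∣ < 1ℚ → m ≡ n
  ι-injective-≈ {m} {n} h with ℕ.<-cmp m n
  ... | tri≈ _ m≡n _ = m≡n
  ... | tri< m<n _ _ = contradiction (<-≤-trans h (ι-gap m<n)) (<-irrefl (∣-∣-swap (ι m) (ι n)))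
  ... | tri> _ _ n<m = contradiction (<-≤-trans h (ι-gap n<m)) (<-irrefl refl)

  module _ {n} (X : Graph n) where

    gram : ∀ x → ⟨ a X · x , a X · x ⟩ ≡ sum (λ v → sum (λ w → sum (λ w′ → a X v w * a X v w′ * (x w * x w′))))
    gram x = sum-cong-≗ λ v → trans (sum-square (λ w → a X v w * x w))
      (sum-cong-≗ λ w → sum-cong-≗ λ w′ → rearr (a X v w) (x w) (a X v w′) (x w′))
      where
      open +-*-Solver
      rearr : ∀ p q r s → p * q * (r * s) ≡ p * r * (q * s)
      rearr = solve 4 (λ p q r s → p :* q :* (r :* s) := p :* r :* (q :* s)) refl

    -- Both squared norms expand into n³ products of two entries with coefficients 0 or 1, and the
    -- hypothesis applies to each of them. The n³ in `tolerance` comes from here.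
    gram-close : ∀ {x y c θ} → (∀ w w′ → ∣ c * (x w * x w′) - y w * y w′ ∣ ≤ θ) →
      ∣ c * ⟨ a X · x , a X · x ⟩ - ⟨ a X · y , a X · y ⟩ ∣ ≤ ι n * (ι n * (ι n * θ))
    gram-close {x} {y} {c} {θ} h = begin
      ∣ c * ⟨ a X · x , a X · x ⟩ - ⟨ a X · y , a X · y ⟩ ∣
        ≡⟨ cong ∣_∣ (trans (cong₂ (λ p q → c * p - q) (gram x) (gram y)) (trans (*sum-sum c (λ v → sum (λ w → sum (f x v w))) (λ v → sum (λ w → sum (f y v w))))
             (sum-cong-≗ λ v → trans (*sum-sum c (λ w → sum (f x v w)) (λ w → sum (f y v w))) (sum-cong-≗ λ w → *sum-sum c (f x v w) (f y v w))))) ⟩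
      ∣ sum (λ v → sum (λ w → sum (λ w′ → c * f x v w w′ - f y v w w′))) ∣
        ≤⟨ ∣sum∣≤ (λ v → ∣sum∣≤ (λ w → ∣sum∣≤ (entry v w))) ⟩
      ι n * (ι n * (ι n * θ)) ∎
      where
      open ≤-Reasoning
      open +-*-Solver
      f : (Fin n → ℚ) → Fin n → Fin n → Fin n → ℚ
      f x v w w′ = a X v w * a X v w′ * (x w * x w′)
      a≤1 : ∀ v w → a X v w ≤ 1ℚ
      a≤1 v w = subst (a X v w ≤_) ι-1 (ι-mono (adj≤1 X v w))
      factor : ∀ c p q r → c * (p * q) - p * r ≡ p * (c * q - r)
      factor = solve 4 (λ c p q r → c :* (p :* q) :- p :* r := p :* (c :* q :- r)) refl
      entry : ∀ v w w′ → ∣ c * f x v w w′ - f y v w w′ ∣ ≤ θ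
      entry v w w′ = begin
        ∣ c * f x v w w′ - f y v w w′ ∣    ≡⟨ cong ∣_∣ (factor c aa (x w * x w′) (y w * y w′)) ⟩
        ∣ aa * d ∣                         ≡⟨ ∣p*q∣≡∣p∣*∣q∣ aa d ⟩
        ∣ aa ∣ * ∣ d ∣                     ≡⟨ cong (_* ∣ d ∣) (0≤p⇒∣p∣≡p 0≤aa) ⟩
        aa * ∣ d ∣                         ≤⟨ *-mono 0≤aa (*-mono (0≤ι (adj X v w)) (a≤1 v w) (0≤ι (adj X v w′)) (a≤1 v w′)) (0≤∣p∣ d) (h w w′) ⟩
        1ℚ * 1ℚ * θ                        ≡⟨ *-identityˡ θ ⟩
        θ                                  ∎
        where
        aa d : ℚ
        aa = a X v w * a X v w′
        d = c * (x w * x w′) - y w * y w′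
        0≤aa : 0ℚ ≤ aa
        0≤aa = *-nonneg (0≤ι (adj X v w)) (0≤ι (adj X v w′))

    module SignedDegrees (y : Fin n → ℚ) where

      -- The neighbours of v sorted by the sign of y, so that s_v is `deg⁺ v` minus `deg⁻ v`. Two
      -- naturals in place of one integer let the congruence modulo 4 become an equation in ℕ.
      deg⁺ deg⁻ : Fin n → ℕ
      deg⁺ v = ℕSum.sum λ w → adj X v w ℕ.* isPos (y w)
      deg⁻ v = ℕSum.sum λ w → adj X v w ℕ.* isNeg (y w)

      isPos+isNeg : ∀ p → isPos p ℕ.+ isNeg p ≡ 1
      isPos+isNeg p = go (0ℚ ≤? p)
        where
        go : ∀ {A : Set} (A? : Dec A) → ⟦ A? ⟧ ℕ.+ (1 ℕ.∸ ⟦ A? ⟧) ≡ 1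
        go (yes _) = refl
        go (no  _) = refl

      deg⁺+deg⁻ : ∀ v → deg⁺ v ℕ.+ deg⁻ v ≡ degree X v
      deg⁺+deg⁻ v = trans (sym (ℕSum.∑-distrib-+ (λ w → adj X v w ℕ.* isPos (y w)) (λ w → adj X v w ℕ.* isNeg (y w))))
        (trans (ℕSum.sum-cong-≗ λ w → trans (sym (ℕ.*-distribˡ-+ (adj X v w) (isPos (y w)) (isNeg (y w))))
          (trans (cong (adj X v w ℕ.*_) (isPos+isNeg (y w))) (ℕ.*-identityʳ (adj X v w))))
        (sym (degree≡ X v)))

      a·sgn : ∀ v → (a X · (sgn ∘ y)) v ≡ ι (deg⁺ v) - ι (deg⁻ v)
      a·sgn v = begin
        sum (λ w → a X v w * (ι (isPos (y w)) - ι (isNeg (y w))))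
          ≡⟨ sum-cong-≗ (λ w → trans (lemma (a X v w) (ι (isPos (y w))) (ι (isNeg (y w))))
               (cong₂ (λ p q → 1ℚ * p - q) (sym (ι-* (adj X v w) (isPos (y w)))) (sym (ι-* (adj X v w) (isNeg (y w)))))) ⟩
        sum (λ w → 1ℚ * ι (adj X v w ℕ.* isPos (y w)) - ι (adj X v w ℕ.* isNeg (y w)))
          ≡⟨ *sum-sum 1ℚ (λ w → ι (adj X v w ℕ.* isPos (y w))) (λ w → ι (adj X v w ℕ.* isNeg (y w))) ⟨
        1ℚ * sum (λ w → ι (adj X v w ℕ.* isPos (y w))) - sum (λ w → ι (adj X v w ℕ.* isNeg (y w)))
          ≡⟨ cong₂ _-_ (trans (*-identityˡ _) (sym (ι-sum (λ w → adj X v w ℕ.* isPos (y w))))) (sym (ι-sum (λ w → adj X v w ℕ.* isNeg (y w)))) ⟩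
        ι (deg⁺ v) - ι (deg⁻ v) ∎
        where
        open ≡-Reasoning
        open +-*-Solver
        lemma : ∀ p q r → p * (q - r) ≡ 1ℚ * (p * q) - p * r
        lemma = solve 3 (λ p q r → p :* (q :- r) := con 1ℚ :* (p :* q) :- p :* r) refl

      P Q : ℕ
      P = ℕSum.sum λ v → 4 ℕ.* (deg⁺ v ℕ.* deg⁻ v)
      Q = ℕSum.sum λ v → degree X v ℕ.* degree X v

      -- At each vertex (p - q)² + 4pq = (p + q)². This is s_v² ≡ d_v² (mod 4) with the multiple of
      -- 4 made explicit.
      ∥a·sgn∥² : ⟨ a X · (sgn ∘ y) , a X · (sgn ∘ y) ⟩ + ι P ≡ ι Q
      ∥a·sgn∥² = begin
        ⟨ a X · (sgn ∘ y) , a X · (sgn ∘ y) ⟩ + ι P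
          ≡⟨ cong (_+_ ⟨ a X · (sgn ∘ y) , a X · (sgn ∘ y) ⟩) (ι-sum (λ v → 4 ℕ.* (deg⁺ v ℕ.* deg⁻ v))) ⟩
        ⟨ a X · (sgn ∘ y) , a X · (sgn ∘ y) ⟩ + sum (λ v → ι (4 ℕ.* (deg⁺ v ℕ.* deg⁻ v)))
          ≡⟨ ∑-distrib-+ (λ v → (a X · (sgn ∘ y)) v * (a X · (sgn ∘ y)) v) (λ v → ι (4 ℕ.* (deg⁺ v ℕ.* deg⁻ v))) ⟨
        sum (λ v → (a X · (sgn ∘ y)) v * (a X · (sgn ∘ y)) v + ι (4 ℕ.* (deg⁺ v ℕ.* deg⁻ v)))
          ≡⟨ sum-cong-≗ entry ⟩
        sum (λ v → ι (degree X v ℕ.* degree X v))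
          ≡⟨ ι-sum (λ v → degree X v ℕ.* degree X v) ⟨
        ι Q ∎
        where
        open ≡-Reasoning
        open +-*-Solver
        polarise : ∀ p q → (p - q) * (p - q) + ((1ℚ + 1ℚ) + (1ℚ + 1ℚ)) * (p * q) ≡ (p + q) * (p + q)
        polarise = solve 2 (λ p q → (p :- q) :* (p :- q) :+ ((con 1ℚ :+ con 1ℚ) :+ (con 1ℚ :+ con 1ℚ)) :* (p :* q) := (p :+ q) :* (p :+ q)) refl
        ι-4 : ι 4 ≡ (1ℚ + 1ℚ) + (1ℚ + 1ℚ)
        ι-4 = trans (ι-+ 2 2) (cong₂ _+_ ι-2 ι-2)
        entry : ∀ v → (a X · (sgn ∘ y)) v * (a X · (sgn ∘ y)) v + ι (4 ℕ.* (deg⁺ v ℕ.* deg⁻ v)) ≡ ι (degree X v ℕ.* degree X v)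
        entry v = begin
          (a X · (sgn ∘ y)) v * (a X · (sgn ∘ y)) v + ι (4 ℕ.* (deg⁺ v ℕ.* deg⁻ v))
            ≡⟨ cong₂ (λ p q → p * p + q) (a·sgn v) (trans (ι-* 4 (deg⁺ v ℕ.* deg⁻ v)) (cong₂ _*_ ι-4 (ι-* (deg⁺ v) (deg⁻ v)))) ⟩
          (ι (deg⁺ v) - ι (deg⁻ v)) * (ι (deg⁺ v) - ι (deg⁻ v)) + ((1ℚ + 1ℚ) + (1ℚ + 1ℚ)) * (ι (deg⁺ v) * ι (deg⁻ v))
            ≡⟨ polarise (ι (deg⁺ v)) (ι (deg⁻ v)) ⟩
          (ι (deg⁺ v) + ι (deg⁻ v)) * (ι (deg⁺ v) + ι (deg⁻ v))
            ≡⟨ cong (λ z → z * z) (trans (sym (ι-+ (deg⁺ v) (deg⁻ v))) (cong ι (deg⁺+deg⁻ v))) ⟩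
          ι (degree X v) * ι (degree X v)
            ≡⟨ ι-* (degree X v) (degree X v) ⟨
          ι (degree X v ℕ.* degree X v) ∎

    -- Entries accurate to η make n deg u and Σ_v s_v² differ by at most (1 + 3n³) n η.
    tolerance : ℕ
    tolerance = (1 ℕ.+ n ℕ.* (n ℕ.* (n ℕ.* 3))) ℕ.* n

    module Rounding (u : Fin n) (y : Fin n → ℚ) (flat : ∀ v → ∣ sq (y v) - 1/size u ∣ ≤ δ tolerance)
      (conserved : ∣ ⟨ a X · y , a X · y ⟩ - ι (degree X u) ∣ ≤ δ tolerance) where
      open ≤-Reasoning
      open +-*-Solver

      d M : ℕ
      d = degree X u
      M = tolerance
      θ : ℚ
      θ = ι n * δ M
      open SignedDegrees y
      k : ℕ
      k = ℕSum.sum λ v → deg⁺ v ℕ.* deg⁻ v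
      S E : ℚ
      S = ⟨ a X · (sgn ∘ y) , a X · (sgn ∘ y) ⟩
      E = ⟨ a X · y , a X · y ⟩
      0≤θ : 0ℚ ≤ θ
      0≤θ = *-nonneg (0≤ι n) (0≤δ M)
      θ≤1 : θ ≤ 1ℚ
      θ≤1 = begin
        ι n * δ M          ≤⟨ *-mono (0≤ι n) (ι-mono (ℕ.m≤m+n n _)) (0≤δ M) ≤-refl ⟩
        ι M * δ M          ≡⟨ cong (ι M *_) (*-identityʳ (δ M)) ⟨
        ι M * (δ M * 1ℚ)   ≤⟨ ι-δ-cancel M 0≤1 ⟩
        1ℚ                 ∎
      -- Inserting n E separates the two errors: n(d - E) from conservation, and n E - S from the
      -- passage to signs.
      split : ∀ n d p s e → n * d + p - (s + p) ≡ n * (d - e) + (n * e - s)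
      split = solve 5 (λ n d p s e → n :* d :+ p :- (s :+ p) := n :* (d :- e) :+ (n :* e :- s)) refl
      ∣ιn*∣ : ∀ p → ∣ ι n * p ∣ ≡ ι n * ∣ p ∣
      ∣ιn*∣ p = trans (∣p*q∣≡∣p∣*∣q∣ (ι n) p) (cong (_* ∣ p ∣) (0≤p⇒∣p∣≡p (0≤ι n)))
      energy-close : ∣ ι n * (ι d - E) ∣ ≤ θ
      energy-close = subst (_≤ θ) (sym (trans (∣ιn*∣ (ι d - E)) (cong (ι n *_) (∣-∣-swap (ι d) E))))
        (*-mono (0≤ι n) ≤-refl (0≤∣p∣ (E - ι d)) conserved)
      scaled : ∀ w → ∣ ι n * sq (y w) - 1ℚ ∣ ≤ θ
      scaled w = begin
        ∣ ι n * sq (y w) - 1ℚ ∣                 ≡⟨ cong (λ z → ∣ ι n * sq (y w) - z ∣) (ι-size u) ⟨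
        ∣ ι n * sq (y w) - ι n * 1/size u ∣     ≡⟨ cong ∣_∣ (factor (ι n) (sq (y w)) (1/size u)) ⟩
        ∣ ι n * (sq (y w) - 1/size u) ∣         ≡⟨ ∣ιn*∣ (sq (y w) - 1/size u) ⟩
        ι n * ∣ sq (y w) - 1/size u ∣           ≤⟨ *-mono (0≤ι n) ≤-refl (0≤∣p∣ (sq (y w) - 1/size u)) (flat w) ⟩
        θ                                       ∎
        where
        factor : ∀ p q r → p * q - p * r ≡ p * (q - r)
        factor = solve 3 (λ p q r → p :* q :- p :* r := p :* (q :- r)) refl
      collect : θ + ι n * (ι n * (ι n * (ι 3 * θ))) ≡ ι M * δ M
      collect = sym (trans (cong (_* δ M) ιM) (assoc (ι n) (ι 3) (δ M)))
        where
        assoc : ∀ n t e → (1ℚ + n * (n * (n * t))) * n * e ≡ n * e + n * (n * (n * (t * (n * e))))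
        assoc = solve 3 (λ n t e → (con 1ℚ :+ n :* (n :* (n :* t))) :* n :* e := n :* e :+ n :* (n :* (n :* (t :* (n :* e))))) refl
        ιM : ι M ≡ (1ℚ + ι n * (ι n * (ι n * ι 3))) * ι n
        ιM = trans (ι-* (1 ℕ.+ n ℕ.* (n ℕ.* (n ℕ.* 3))) n) (cong (_* ι n) (trans (ι-+ 1 (n ℕ.* (n ℕ.* (n ℕ.* 3)))) (cong₂ _+_ ι-1
          (trans (ι-* n (n ℕ.* (n ℕ.* 3))) (cong (ι n *_) (trans (ι-* n (n ℕ.* 3)) (cong (ι n *_) (ι-* n 3))))))))


      -- `δ M` is 1/(M+1), so the total error M/(M+1) is strictly less than the gap between distinct
      -- integers.
      below-one : ι M * δ M < 1ℚ
      below-one = subst (_< 1ℚ) (*-comm (δ M) (ι M)) (subst (δ M * ι M <_) (δ-inv M) (*-monoʳ-<-pos (δ M) {{positive (0<δ M)}} (ι-mono-< (ℕ.n<1+n M))))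

      S-close : ∣ ι n * E - S ∣ ≤ ι n * (ι n * (ι n * (ι 3 * θ)))
      S-close = gram-close {y} {sgn ∘ y} {ι n} λ w w′ → sgn-close {ι n} {y w} {y w′} (0≤ι n) 0≤θ θ≤1 (scaled w) (scaled w′)

      close : ∣ ι (n ℕ.* d ℕ.+ P) - ι Q ∣ < 1ℚ
      close = begin-strict
        ∣ ι (n ℕ.* d ℕ.+ P) - ι Q ∣
          ≡⟨ cong₂ (λ p q → ∣ p - q ∣) (trans (ι-+ (n ℕ.* d) P) (cong (_+ ι P) (ι-* n d))) (sym ∥a·sgn∥²) ⟩
        ∣ ι n * ι d + ι P - (S + ι P) ∣
          ≡⟨ cong ∣_∣ (split (ι n) (ι d) (ι P) S E) ⟩
        ∣ ι n * (ι d - E) + (ι n * E - S) ∣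
          ≤⟨ ∣p+q∣≤∣p∣+∣q∣ (ι n * (ι d - E)) (ι n * E - S) ⟩
        ∣ ι n * (ι d - E) ∣ + ∣ ι n * E - S ∣
          ≤⟨ +-mono-≤ energy-close S-close ⟩
        θ + ι n * (ι n * (ι n * (ι 3 * θ)))
          ≡⟨ collect ⟩
        ι M * δ M
          <⟨ below-one ⟩
        1ℚ ∎

      rounded : n ℕ.* d ℕ.+ 4 ℕ.* k ≡ Q
      rounded = trans (cong (ℕ._+_ (n ℕ.* d)) (ℕSum.*-distribˡ-sum 4 (λ v → deg⁺ v ℕ.* deg⁻ v)))
        (ι-injective-≈ {n ℕ.* d ℕ.+ P} {Q} close)

    degree-squares : Bipartite X → ∀ u → LocalεUniformMixing X u →
      ∃[ k ] n ℕ.* degree X u ℕ.+ 4 ℕ.* k ≡ ℕSum.sum (λ v → degree X v ℕ.* degree X v)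
    degree-squares bip u mix =
      let y , flat , conserved = approximate-state X bip u mix (δ tolerance) (0<δ tolerance)
      in Rounding.k u y flat conserved , Rounding.rounded u y flat conserved

-- Counting edges and degrees modulo 4.

open import Data.Nat.Base using (_+_; _*_; _/_; _%_; _<_)
open import Data.Nat.DivMod using (m≡m%n+[m/n]*n; m%n<n; [m+kn]%n≡m%n; %-distribˡ-+; m/n*n≡m)
open import Data.Nat.Divisibility using (_∣_; divides; divides-refl; ∣m+n∣m⇒∣n; m%n≡0⇒n∣m)
open import Data.Nat.Primality using (euclidsLemma; prime[2])
open import Data.Nat.Properties using (_≟_; +-comm; *-cancelʳ-≡; +-*-semiring)
open import Data.Nat.Tactic.RingSolver using (solve-∀)
open import Function.Bundles using (_⇔_; mk⇔)
open import Algebra.Properties.Semiring.Sum +-*-semiring using (sum; sum-cong-≗; ∑-comm; ∑-distrib-+; *-distribˡ-sum)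

length-filter-product : ∀ {a b p} {A : Set a} {B : Set b} {P : Pred (A × B) p} (P? : Decidable P)
  {m n} (f : Fin m → A) (g : Fin n → B) →
  length (filter P? (cartesianProduct (tabulate f) (tabulate g))) ≡ sum (λ i → sum (λ j → ⟦ P? (f i , g j) ⟧))
length-filter-product P? {zero}  f g = refl
length-filter-product P? {suc m} f g = begin
  length (filter P? (row ++ rest))                   ≡⟨ cong length (filter-++ P? row rest) ⟩
  length (filter P? row ++ filter P? rest)           ≡⟨ length-++ (filter P? row) ⟩
  length (filter P? row) + length (filter P? rest)   ≡⟨ cong₂ _+_
    (trans (cong (length ∘ filter P?) (map-tabulate g (f zero ,_))) (length-filter-tabulate P? (λ j → f zero , g j)))
    (length-filter-product P? (f ∘ suc) g) ⟩
  _                                                  ∎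
  where
  open ≡-Reasoning
  row = map (f zero ,_) (tabulate g)
  rest = cartesianProduct (tabulate (f ∘ suc)) (tabulate g)

⟦⟧-true : ∀ {a} {A : Set a} (A? : Dec A) → A → ⟦ A? ⟧ ≡ 1
⟦⟧-true (yes _)  _ = refl
⟦⟧-true (no ¬a) a = contradiction a ¬a

⟦⟧-false : ∀ {a} {A : Set a} (A? : Dec A) → ¬ A → ⟦ A? ⟧ ≡ 0
⟦⟧-false (yes a) ¬a = contradiction a ¬a
⟦⟧-false (no _)  _ = refl

module _ {n} (X : Graph n) where
  open Graph X

  edge? : (u v : Fin n) → Dec _
  edge? u v = (u Fin.<? v) ×-dec (u ~? v)

  -- By trichotomy an edge is listed in exactly one of its two orders; irreflexivity excludes u = v.
  adj-split : ∀ u v → adj X u v ≡ ⟦ edge? u v ⟧ + ⟦ edge? v u ⟧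
  adj-split u v = go (u ~? v)
    where
    go : (d : Dec (u ~ v)) → ⟦ d ⟧ ≡ ⟦ edge? u v ⟧ + ⟦ edge? v u ⟧
    go (no u≁v) = sym (cong₂ _+_ (⟦⟧-false (edge? u v) (u≁v ∘ proj₂)) (⟦⟧-false (edge? v u) (u≁v ∘ ~-sym ∘ proj₂)))
    go (yes u~v) with Fin.<-cmp u v
    ... | tri< u<v _ v≮u = sym (cong₂ _+_ (⟦⟧-true (edge? u v) (u<v , u~v)) (⟦⟧-false (edge? v u) (v≮u ∘ proj₁)))
    ... | tri≈ _ u≡v _   = contradiction u~v (~-irrefl u≡v)
    ... | tri> u≮v _ v<u = sym (cong₂ _+_ (⟦⟧-false (edge? u v) (u≮v ∘ proj₁)) (⟦⟧-true (edge? v u) (v<u , ~-sym u~v)))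

  handshake : sum (degree X) ≡ #edges X + #edges X
  handshake = begin
    sum (degree X)
      ≡⟨ sum-cong-≗ (degree≡ X) ⟩
    sum (λ u → sum (adj X u))
      ≡⟨ sum-cong-≗ (λ u → trans (sum-cong-≗ (adj-split u)) (∑-distrib-+ (λ v → ⟦ edge? u v ⟧) (λ v → ⟦ edge? v u ⟧))) ⟩
    sum (λ u → sum (λ v → ⟦ edge? u v ⟧) + sum (λ v → ⟦ edge? v u ⟧))
      ≡⟨ ∑-distrib-+ (λ u → sum (λ v → ⟦ edge? u v ⟧)) (λ u → sum (λ v → ⟦ edge? v u ⟧)) ⟩
    sum (λ u → sum (λ v → ⟦ edge? u v ⟧)) + sum (λ u → sum (λ v → ⟦ edge? v u ⟧))
      ≡⟨ cong₂ _+_ count (trans (∑-comm (λ u v → ⟦ edge? v u ⟧)) count) ⟩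
    #edges X + #edges X ∎
    where
    open ≡-Reasoning
    count : sum (λ u → sum (λ v → ⟦ edge? u v ⟧)) ≡ #edges X
    count = sym (length-filter-product (λ (u , v) → edge? u v) (λ u → u) (λ v → v))

2,3mod4? : (d : ℕ) → Dec (d % 4 ≡ 2 ⊎ d % 4 ≡ 3)
2,3mod4? d = (d % 4 ≟ 2) ⊎-dec (d % 4 ≟ 3)

-- d(d - 1) is 0, 0, 2, 2 modulo 4 for the residues 0, 1, 2, 3. The summand 4 (d / 4) keeps the
-- witness natural: for d = 4q the difference d² - d is 16q² - 4q, with a negative term that it
-- absorbs.
square-mod-4 : ∀ d → ∃[ e ] d * d + 4 * (d / 4) ≡ d + 2 * ⟦ 2,3mod4? d ⟧ + 4 * e
square-mod-4 d = go (d % 4) (m%n<n d 4) (m≡m%n+[m/n]*n d 4)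
  where
  q = d / 4
  case₀ : ∀ q → (0 + q * 4) * (0 + q * 4) + 4 * q ≡ 0 + q * 4 + 0 + 4 * (4 * q * q)
  case₀ = solve-∀
  case₁ : ∀ q → (1 + q * 4) * (1 + q * 4) + 4 * q ≡ 1 + q * 4 + 0 + 4 * (4 * q * q + 2 * q)
  case₁ = solve-∀
  case₂ : ∀ q → (2 + q * 4) * (2 + q * 4) + 4 * q ≡ 2 + q * 4 + 2 + 4 * (4 * q * q + 4 * q)
  case₂ = solve-∀
  case₃ : ∀ q → (3 + q * 4) * (3 + q * 4) + 4 * q ≡ 3 + q * 4 + 2 + 4 * (4 * q * q + 6 * q + 1)
  case₃ = solve-∀
  transport : ∀ {r i} e → d ≡ r + q * 4 → (r + q * 4) * (r + q * 4) + 4 * q ≡ r + q * 4 + i + 4 * e → d * d + 4 * q ≡ d + i + 4 * e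
  transport {i = i} e d≡ = subst (λ d → d * d + 4 * q ≡ d + i + 4 * e) (sym d≡)
  -- The residue is a free variable here, so that the indicator computes at each literal value.
  go : ∀ r → r < 4 → d ≡ r + q * 4 → ∃[ e ] d * d + 4 * q ≡ d + 2 * ⟦ (r ≟ 2) ⊎-dec (r ≟ 3) ⟧ + 4 * e
  go 0 _ d≡ = 4 * q * q , transport (4 * q * q) d≡ (case₀ q)
  go 1 _ d≡ = 4 * q * q + 2 * q , transport (4 * q * q + 2 * q) d≡ (case₁ q)
  go 2 _ d≡ = 4 * q * q + 4 * q , transport (4 * q * q + 4 * q) d≡ (case₂ q)
  go 3 _ d≡ = 4 * q * q + 6 * q + 1 , transport (4 * q * q + 6 * q + 1) d≡ (case₃ q)
  go (suc (suc (suc (suc _)))) (s≤s (s≤s (s≤s (s≤s ()))))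

squares-mod-4 : ∀ {n} (X : Graph n) → ∃[ k ] ∃[ e ]
  sum (λ v → degree X v * degree X v) + 4 * k ≡ (#edges X + #edges X) + 2 * #deg≡2,3mod4 X + 4 * e
squares-mod-4 {n} X = sum q , sum e , (begin
  sum (λ v → d v * d v) + 4 * sum q
    ≡⟨ cong (sum (λ v → d v * d v) +_) (*-distribˡ-sum 4 q) ⟩
  sum (λ v → d v * d v) + sum (λ v → 4 * q v)
    ≡⟨ ∑-distrib-+ (λ v → d v * d v) (λ v → 4 * q v) ⟨
  sum (λ v → d v * d v + 4 * q v)
    ≡⟨ sum-cong-≗ (λ v → proj₂ (square-mod-4 (d v))) ⟩
  sum (λ v → d v + 2 * i v + 4 * e v)
    ≡⟨ ∑-distrib-+ (λ v → d v + 2 * i v) (λ v → 4 * e v) ⟩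
  sum (λ v → d v + 2 * i v) + sum (λ v → 4 * e v)
    ≡⟨ cong₂ _+_ (∑-distrib-+ d (λ v → 2 * i v)) (sym (*-distribˡ-sum 4 e)) ⟩
  sum d + sum (λ v → 2 * i v) + 4 * sum e
    ≡⟨ cong (λ z → sum d + z + 4 * sum e) (sym (*-distribˡ-sum 2 i)) ⟩
  sum d + 2 * sum i + 4 * sum e
    ≡⟨ cong₂ (λ y z → y + 2 * z + 4 * sum e) (handshake X)
         (sym (length-filter-tabulate (λ v → 2,3mod4? (d v)) (λ v → v))) ⟩
  (#edges X + #edges X) + 2 * #deg≡2,3mod4 X + 4 * sum e ∎)
  where
  open ≡-Reasoning
  d q e i : Fin n → ℕ
  d = degree X
  q v = d v / 4
  e v = proj₁ (square-mod-4 (d v))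
  i v = ⟦ 2,3mod4? (d v) ⟧

∣⇔≡%2 : ∀ m n → 2 ∣ m ⇔ n % 2 ≡ (n + m) % 2
∣⇔≡%2 m n = mk⇔ to from
  where
  to : 2 ∣ m → n % 2 ≡ (n + m) % 2
  to (divides-refl k) = sym ([m+kn]%n≡m%n n k 2)
  cancel : ∀ a b → a < 2 → b < 2 → a ≡ (a + b) % 2 → b ≡ 0
  cancel _ 0 _ _ _ = refl
  cancel 0 1 _ _ ()
  cancel 1 1 _ _ ()
  cancel (suc (suc _)) _ (s≤s (s≤s ())) _ _
  cancel _ (suc (suc _)) _ (s≤s (s≤s ())) _
  from : n % 2 ≡ (n + m) % 2 → 2 ∣ m
  from eq = m%n≡0⇒n∣m m 2 (cancel (n % 2) (m % 2) (m%n<n n 2) (m%n<n m 2) (trans eq (%-distribˡ-+ n m 2)))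

-- Eliminating S gives nd + 4(k + q) = 2(E + N + 2e). Hence nd is even, its exact half satisfies
-- nd/2 ≡ E + N (mod 2), and it has the parity of E precisely when N is even.
parity : ∀ n d N E S → ∃[ k ] n * d + 4 * k ≡ S → ∃[ q ] ∃[ e ] S + 4 * q ≡ (E + E) + 2 * N + 4 * e →
  (2 ∣ n ⊎ 2 ∣ d) × (2 ∣ N ⇔ E % 2 ≡ (n * d / 2) % 2)
parity n d N E S (k , nd≡) (q , e , S≡) =
  euclidsLemma n d prime[2] 2∣nd , subst (λ z → 2 ∣ N ⇔ E % 2 ≡ z) (sym h%2) (∣⇔≡%2 N E)
  where
  open ≡-Reasoning
  h : ℕ
  h = n * d / 2
  total : n * d + (2 * k + 2 * q) * 2 ≡ (E + N + e * 2) * 2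
  total = trans (left (n * d) k q) (trans (cong (_+ 4 * q) nd≡) (trans S≡ (right E N e)))
    where
    left : ∀ a k q → a + (2 * k + 2 * q) * 2 ≡ a + 4 * k + 4 * q
    left = solve-∀
    right : ∀ E N e → (E + E) + 2 * N + 4 * e ≡ (E + N + e * 2) * 2
    right = solve-∀
  2∣nd : 2 ∣ n * d
  2∣nd = ∣m+n∣m⇒∣n (divides (E + N + e * 2) (trans (+-comm ((2 * k + 2 * q) * 2) (n * d)) total)) (divides-refl (2 * k + 2 * q))
  halved : h + (k + q) * 2 ≡ E + N + e * 2
  halved = *-cancelʳ-≡ _ _ 2 (trans (double h k q) (trans (cong (_+ (2 * k + 2 * q) * 2) (m/n*n≡m 2∣nd)) total))
    where
    double : ∀ h k q → (h + (k + q) * 2) * 2 ≡ h * 2 + (2 * k + 2 * q) * 2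
    double = solve-∀
  h%2 : h % 2 ≡ (E + N) % 2
  h%2 = begin
    h % 2                  ≡⟨ [m+kn]%n≡m%n h (k + q) 2 ⟨
    (h + (k + q) * 2) % 2  ≡⟨ cong (_% 2) halved ⟩
    (E + N + e * 2) % 2    ≡⟨ [m+kn]%n≡m%n (E + N) e 2 ⟩
    (E + N) % 2            ∎

corollary20 : ∀ {n : ℕ} (X : Graph n) → Bipartite X → (u : Fin n) → LocalεUniformMixing X u →
    (2 ∣ n ⊎ 2 ∣ degree X u) × (2 ∣ #deg≡2,3mod4 X ⇔ #edges X % 2 ≡ (n * degree X u / 2) % 2)
corollary20 {n} X bip u mix = parity n (degree X u) (#deg≡2,3mod4 X) (#edges X) (sum λ v → degree X v * degree X v)
  (degree-squares X bip u mix) (squares-mod-4 X)
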